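{- Let $G$ be a planar graph satisfying at least one of the following conditions: (i) no two triangles of $G$ are intersecting, and every triangle is adjacent to at most one $4$-cycle; (ii) no triangle of $G$ is adjacent to a triangle or a $4$-cycle, and every $5$-cycle is adjacent to at most three triangles. Then $G$ is single conflict $3$-colorable.
   Context: Graphs are finite and simple. Two (distinct) cycles are adjacent if they share a common edge; they are intersecting if they share a common vertex. A local $k$-partition of $G$ is a collection $\{c_v\}_{v\in V(G)}$ of maps $c_v : E(v)\to\{1,\dots,k\}$, where $E(v)$ is the set of edges incident with $v$. $G$ is conflict $\{c_v\}$-colorable if there is a map $\varphi : V(G)\to\{1,\dots,k\}$ such that no edge $e=xy$ satisfies both $\varphi(x)=c_x(e)$ and $\varphi(y)=c_y(e)$. $G$ is single conflict $k$-colorable if it is conflict $\{c_v\}$-colorable for every local $k$-partition $\{c_v\}$. -}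

module Defs where

open import Data.Bool using (Bool; false; T)
open import Data.Nat using (ℕ; zero; suc; _+_; _*_; _≤_)
open import Data.Nat.DivMod using (_mod_)
open import Data.Fin using (Fin; toℕ)
open import Data.Product using (Σ; ∃; ∃₂; _×_; _,_)
open import Data.Sum using (_⊎_)
open import Function.Bundles using (Bijection; _⇔_; _↔_; Inverse)
open import Function.Definitions using (Injective)
open import Level using (0ℓ)
open import Relation.Binary.Core using (Rel)
open import Relation.Binary.PropositionalEquality using (_≡_; _≢_; subst; setoid)
import Relation.Binary.Construct.Closure.Equivalence as EqC
open import Relation.Nullary using (¬_)

-- Finite simple graphs on the vertex set Fin n.  Adjacency is Boolean, hence
-- decidable, and a proof of u ~ v is unique.
record Graph (n : ℕ) : Set where
  field
    adj        : Fin n → Fin n → Bool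
    adj-sym    : ∀ u v → adj u v ≡ adj v u
    adj-irrefl : ∀ v → adj v v ≡ false

  Adj : Rel (Fin n) 0ℓ
  Adj u v = T (adj u v)

  reverse-edge : ∀ {u v} → Adj u v → Adj v u
  reverse-edge {u} {v} = subst T (adj-sym u v)

-- The equivalence relation generated by R has exactly k classes.
ClassCount : {A : Set} → Rel A 0ℓ → ℕ → Set
ClassCount R k = Bijection (EqC.setoid R) (setoid (Fin k))

module _ {n : ℕ} (G : Graph n) where
  open Graph G

  -- An edge together with one of its two directions.
  record Dart : Set where
    constructor dart
    field
      source target : Fin n
      edge          : Adj source target

  open Dart

  opposite : Dart → Dart
  opposite (dart u v e) = dart v u (reverse-edge e)

  Step : (Dart → Dart) → Rel Dart 0ℓ
  Step f d d′ = f d ≡ d′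

  -- A rotation system: for every vertex v, a cyclic order on the darts leaving
  -- v, given by one permutation of all darts whose orbits are precisely the
  -- sets of darts with a common source.  (The orbits of a permutation f are
  -- the classes of the equivalence relation generated by Step f.)
  record RotationSystem : Set where
    field
      rotation : Dart ↔ Dart

    σ : Dart → Dart
    σ = Inverse.to rotation

    field
      orbits : ∀ d d′ → EqC.EqClosure (Step σ) d d′ ⇔ source d ≡ source d′

    -- The facial walk arriving along d leaves along the dart that follows
    -- the reversal of d in the rotation at the target of d.
    face : Dart → Dart
    face d = σ (opposite d)

  -- Euler's formula V − E + F = 2C for the map defined by the rotation system,
  -- i.e. each component is embedded in a sphere (F counts the facial walks of
  -- each component separately).  Isolated vertices carry no dart, so neither
  -- they nor their components and faces are counted; this does not affect
  -- embeddability.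
  GenusZero : RotationSystem → Set
  GenusZero ρ =
    ∃₂ λ V E → ∃₂ λ F C →
      ClassCount (Step σ) V × ClassCount (Step opposite) E ×
      ClassCount (Step face) F ×
      ClassCount (λ d d′ → Step σ d d′ ⊎ Step opposite d d′) C ×
      V + F ≡ E + 2 * C
    where open RotationSystem ρ

  -- Planarity in combinatorial form: the graph has a spherical embedding,
  -- described by its rotation system.
  Planar : Set
  Planar = ∃ GenusZero

next : ∀ {k} → Fin k → Fin k
next {suc k} i = suc (toℕ i) mod suc k

-- A k-cycle, presented by one of its cyclic vertex sequences.  Different
-- sequences may present the same cycle; see _≈_ below.
record Cycle {n : ℕ} (G : Graph n) (k : ℕ) : Set where
  open Graph G
  field
    3≤length : 3 ≤ k
    vertex   : Fin k → Fin n
    distinct : Injective _≡_ _≡_ vertex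
    joined   : ∀ i → Adj (vertex i) (vertex (next i))

  HasVertex : Fin n → Set
  HasVertex v = ∃ λ i → vertex i ≡ v

  HasEdge : Rel (Fin n) 0ℓ
  HasEdge u v = ∃ λ i → (vertex i ≡ u × vertex (next i) ≡ v)
                      ⊎ (vertex i ≡ v × vertex (next i) ≡ u)

module _ {n : ℕ} {G : Graph n} where
  open Cycle

  infix 4 _≈_

  -- Equality of cycles as subgraphs: the same edges.
  _≈_ : ∀ {k l} → Cycle G k → Cycle G l → Set
  c ≈ d = ∀ u v → HasEdge c u v ⇔ HasEdge d u v

  Adjacent : ∀ {k l} → Cycle G k → Cycle G l → Set
  Adjacent c d = ¬ (c ≈ d) × ∃₂ λ u v → HasEdge c u v × HasEdge d u v

  Intersecting : ∀ {k l} → Cycle G k → Cycle G l → Set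
  Intersecting c d = ¬ (c ≈ d) × ∃ λ v → HasVertex c v × HasVertex d v

  -- At most m different k-cycles satisfy P: any m + 1 presentations of
  -- k-cycles satisfying P include two of the same cycle.
  AtMost : ∀ {k} → ℕ → (Cycle G k → Set) → Set
  AtMost {k} m P = (c : Fin (suc m) → Cycle G k) → (∀ i → P (c i)) →
                   ∃₂ λ i j → i ≢ j × c i ≈ c j

module _ {n : ℕ} (G : Graph n) where
  open Graph G

  Triangle : Set
  Triangle = Cycle G 3

  NoIntersectingTriangles : Set
  NoIntersectingTriangles = (t t′ : Triangle) → ¬ Intersecting t t′

  TrianglesAdjacentToAtMostOne4Cycle : Set
  TrianglesAdjacentToAtMostOne4Cycle =
    (t : Triangle) → AtMost 1 (λ (c : Cycle G 4) → Adjacent t c)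

  NoTriangleAdjacentTo3Or4Cycle : Set
  NoTriangleAdjacentTo3Or4Cycle =
    (t : Triangle) → ((t′ : Triangle) → ¬ Adjacent t t′) ×
                     ((c : Cycle G 4) → ¬ Adjacent t c)

  5CyclesAdjacentToAtMostThreeTriangles : Set
  5CyclesAdjacentToAtMostThreeTriangles =
    (c : Cycle G 5) → AtMost 3 (λ (t : Triangle) → Adjacent c t)

  -- For c : LocalPartition k and e : Adj v w, the value c v w e is c_v(vw):
  -- the edges incident with v are indexed by their other end w.
  LocalPartition : ℕ → Set
  LocalPartition k = ∀ v w → Adj v w → Fin k

  ConflictColorable : ∀ {k} → LocalPartition k → Set
  ConflictColorable {k} c =
    Σ (Fin n → Fin k) λ φ →
      ∀ x y (e : Adj x y) → ¬ (φ x ≡ c x y e × φ y ≡ c y x (reverse-edge e))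

  SingleConflictColorable : ℕ → Set
  SingleConflictColorable k = (c : LocalPartition k) → ConflictColorable c

-- A vertex that owns at most two of its edges can avoid its conflict colour at each of
-- them, and every edge is safe once one of its ends owns it.  So it suffices to orient G
-- with all outdegrees at most 2, which is possible if every set of s vertices spans at
-- most 2s edges (Hakimi).  In a minimal counterexample to the latter all degrees are at
-- least 3.  Then face boundaries of length at most 5 are cycles, and discharging, in which
-- every face of length at least 5 sends one unit across each edge to a triangular face,
-- shows that the average face length is at least 4; with Euler's inequality V + F ≥ E this
-- gives E ≤ 2V.
--
-- A subgraph inherits Euler's inequality by detaching the darts it misses from their
-- vertices: the set of darts stays the same, the vertex and face permutations are composed
-- with a transposition, and the numbers of orbits and components can be controlled.
--
-- The conclusions are decidable, so the existence arguments may use excluded middle under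
-- a double negation.
module Submission where

open import Defs
open import Data.Bool using (Bool; true; false; not; if_then_else_; T; _∧_; _∨_)
open import Data.Bool.Properties using (T-irrelevant; T-≡; T-∧; T-∨; ∧-comm; ∨-zeroʳ)
open import Data.Empty using (⊥; ⊥-elim)
open import Data.Fin as Fin using (Fin; zero; suc; toℕ; punchIn; punchOut; finToFun; funToFin; _≟_)
open import Data.Fin.Patterns
open import Data.Fin.Permutation.Components using (transpose)
import Data.Fin.Properties as FinP
open import Data.List using (List; []; _∷_; length; lookup; filter; map; tabulate; allFin; cartesianProduct)
import Data.List.Membership.DecPropositional as DecMembership
open import Data.List.Membership.Propositional using (_∈_; _∉_)
open import Data.List.Membership.Propositional.Properties
  using (∈-lookup; ∈-filter⁺; ∈-filter⁻; ∈-map⁺; ∈-map⁻; ∈-cartesianProduct⁺; ∈-allFin)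
open import Data.List.Relation.Unary.All as All using ([]; _∷_)
open import Data.List.Relation.Unary.AllPairs using ([]; _∷_)
open import Data.List.Relation.Unary.Any using (here; there; index)
open import Data.List.Relation.Unary.Any.Properties using (lookup-index)
open import Data.List.Relation.Unary.Unique.Propositional using (Unique)
open import Data.List.Relation.Unary.Unique.Propositional.Properties using (filter⁺; cartesianProduct⁺; allFin⁺)
open import Data.Nat as ℕ using (ℕ; zero; suc; _+_; _*_; _∸_; _≤_; _<_; z≤n; s≤s)
open import Data.Nat.Induction using (<-wellFounded)
open import Data.Nat.Properties hiding (_≟_)
open import Data.Nat.Tactic.RingSolver using (solve-∀)
open import Data.Product using (Σ; ∃; ∃₂; _×_; _,_; proj₁; proj₂)
open import Data.Sum using (_⊎_; inj₁; inj₂; [_,_]′)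
open import Data.Unit using (⊤; tt)
open import Effect.Monad using (RawMonad)
open import Function using (_∘_; id)
open import Function.Bundles using (_↔_; Inverse; mk↔; Bijection; Equivalence; mk⇔)
open import Function.Definitions using (Injective)
open import Induction.WellFounded using (Acc; acc)
open import Level using (0ℓ)
open import Relation.Binary.Construct.Closure.Equivalence as EqC using (EqClosure)
open import Relation.Binary.Core using (Rel)
open import Relation.Binary.Definitions using (Tri; tri<; tri≈; tri>)
open import Relation.Binary.PropositionalEquality
  using (_≡_; _≢_; refl; sym; trans; cong; cong₂; subst; subst₂; module ≡-Reasoning; isEquivalence)
open import Relation.Nullary using (¬_; Dec; yes; no; does; contradiction)
open import Relation.Nullary.Decidable
  using (T?; ¬?; _×-dec_; map′; dec-true; dec-false; decidable-stable; ¬¬-excluded-middle)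
open import Relation.Nullary.Negation using (¬¬-Monad; ¬¬-map)

open import Algebra.Properties.Semiring.Sum +-*-semiring
  using (sum; sum-cong-≗; ∑-distrib-+; ∑-comm; *-distribˡ-sum)
open RawMonad (¬¬-Monad {0ℓ}) using (rawApplicative; _>>=_; return)

-- Finite sums and counting

-- Hakimi's condition concerns every induced subgraph, whereas the embedding is given for the whole
-- graph, and connectivity may be lost on the way. This is why detached edges stay in the map: each
-- becomes a component with two vertices and one face of length 2, contributes equally to both sides
-- of E + 2C ≤ V + F, and cancels at the end. Only inequalities are carried along, so V and F are
-- lower bounds for numbers of orbits and C is an upper bound for the number of components.
--
-- Both conditions restrict cycles of `G`. They pass to the subgraph because its faces of length 3,
-- 4 and 5 bound cycles of `G`.
--
-- The scale `k` of the discharging depends on the condition. Each dart starts with k and each face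
-- must end with at least 4k, so a triangle lacks k, a pentagon has k to spare and a longer face at
-- least 2k. Under (i), k = 2: a triangle gets a unit across at least two sides, and a pentagon,
-- whose consecutive sides cannot both border triangles, gives at most two. Under (ii), k = 3: a
-- triangle gets a unit across all three sides, and a pentagon gives at most three.

¬¬-Fin : ∀ {n} {P : Fin n → Set} → (∀ i → ¬ ¬ P i) → ¬ ¬ (∀ i → P i)
¬¬-Fin = FinP.sequence rawApplicative

⟦_⟧ : ∀ {P : Set} → Dec P → ℕ
⟦ P? ⟧ = if does P? then 1 else 0

⟦⟧-yes : ∀ {P : Set} (P? : Dec P) → P → ⟦ P? ⟧ ≡ 1
⟦⟧-yes P? p rewrite dec-true P? p = refl

⟦⟧-no : ∀ {P : Set} (P? : Dec P) → ¬ P → ⟦ P? ⟧ ≡ 0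
⟦⟧-no P? ¬p rewrite dec-false P? ¬p = refl

⟦⟧≤1 : ∀ {P : Set} (P? : Dec P) → ⟦ P? ⟧ ≤ 1
⟦⟧≤1 (yes _) = ≤-refl
⟦⟧≤1 (no  _) = z≤n

⟦⟧-mono : ∀ {P Q : Set} (P? : Dec P) (Q? : Dec Q) → (P → Q) → ⟦ P? ⟧ ≤ ⟦ Q? ⟧
⟦⟧-mono (yes p) Q? P⇒Q rewrite dec-true Q? (P⇒Q p) = ≤-refl
⟦⟧-mono (no  _) Q? P⇒Q = z≤n

⟦⟧-cong : ∀ {P Q : Set} (P? : Dec P) (Q? : Dec Q) → (P → Q) → (Q → P) → ⟦ P? ⟧ ≡ ⟦ Q? ⟧
⟦⟧-cong P? Q? P⇒Q Q⇒P = ≤-antisym (⟦⟧-mono P? Q? P⇒Q) (⟦⟧-mono Q? P? Q⇒P)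

sum-mono-≤ : ∀ {n} {f g : Fin n → ℕ} → (∀ i → f i ≤ g i) → sum f ≤ sum g
sum-mono-≤ {zero}  f≤g = z≤n
sum-mono-≤ {suc n} f≤g = +-mono-≤ (f≤g zero) (sum-mono-≤ (f≤g ∘ suc))

sum-mono-< : ∀ {n} {f g : Fin n → ℕ} → (∀ i → f i ≤ g i) → ∀ i → f i < g i → sum f < sum g
sum-mono-< f≤g zero    fi<gi = +-mono-<-≤ fi<gi (sum-mono-≤ (f≤g ∘ suc))
sum-mono-< f≤g (suc i) fi<gi = +-mono-≤-< (f≤g zero) (sum-mono-< (f≤g ∘ suc) i fi<gi)

sum-const : ∀ n c → sum {n} (λ _ → c) ≡ n * c
sum-const zero    c = refl
sum-const (suc n) c = cong (c +_) (sum-const n c)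

sum-zero : ∀ {n} {f : Fin n → ℕ} → (∀ i → f i ≡ 0) → sum f ≡ 0
sum-zero {n} f≡0 = trans (sum-cong-≗ f≡0) (trans (sum-const n 0) (*-zeroʳ n))

sum-δ : ∀ {n} (i : Fin n) (f : Fin n → ℕ) → sum (λ j → ⟦ i ≟ j ⟧ * f j) ≡ f i
sum-δ {suc n} zero    f = trans (cong₂ _+_ (+-identityʳ (f zero)) (sum-zero {n} {λ _ → 0} λ _ → refl))
    (+-identityʳ _)
sum-δ {suc n} (suc i) f = trans (sum-cong-≗ λ j →
    cong (_* f (suc j)) (⟦⟧-cong (suc i ≟ suc j) (i ≟ j) FinP.suc-injective (cong suc))) (sum-δ i (f ∘ suc))

sum-fibres : ∀ {m k} (φ : Fin m → Fin k) (f : Fin m → ℕ) →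
             sum (λ i → sum (λ d → ⟦ φ d ≟ i ⟧ * f d)) ≡ sum f
sum-fibres φ f = trans (∑-comm λ i d → ⟦ φ d ≟ i ⟧ * f d) (sum-cong-≗ λ d → sum-δ (φ d) (λ _ → f d))

sum-injection : ∀ {m n} {g : Fin m → Fin n} → Injective _≡_ _≡_ g → (f : Fin n → ℕ) →
                sum (f ∘ g) ≤ sum f
sum-injection {m} {n} {g} g-inj f = begin
  sum (f ∘ g)                                  ≡⟨ sum-fibres g (f ∘ g) ⟨
  sum (λ j → sum (λ i → ⟦ g i ≟ j ⟧ * f (g i))) ≤⟨ sum-mono-≤ fibre ⟩
  sum f                                        ∎
  where
  open ≤-Reasoning
  fibre : ∀ j → sum (λ i → ⟦ g i ≟ j ⟧ * f (g i)) ≤ f j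
  fibre j with FinP.any? (λ i → g i ≟ j)
  ... | no ∄  = ≤-trans (≤-reflexive (sum-zero λ i → cong (_* f (g i)) (⟦⟧-no (g i ≟ j) λ e → ∄ (i , e)))) z≤n
  ... | yes (k , refl) = ≤-reflexive (trans
    (sum-cong-≗ λ i → cong (_* f (g i)) (⟦⟧-cong (g i ≟ g k) (k ≟ i) (sym ∘ g-inj) (cong g ∘ sym)))
    (sum-δ k (f ∘ g)))

sum-involution : ∀ {n} {α : Fin n → Fin n} → (∀ d → α (α d) ≡ d) → (f : Fin n → ℕ) →
                 sum (f ∘ α) ≡ sum f
sum-involution {α = α} αα f = ≤-antisym (sum-injection inj f)
  (≤-trans (≤-reflexive (sum-cong-≗ λ d → cong f (sym (αα d)))) (sum-injection inj (f ∘ α)))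
  where
  inj : Injective _≡_ _≡_ α
  inj e = trans (sym (αα _)) (trans (cong α e) (αα _))

count-< : ∀ {m} {P : Fin m → Set} (P? : ∀ i → Dec (P i)) → ¬ (∀ i → P i) → sum (λ i → ⟦ P? i ⟧) < m
count-< {m} P? ¬all with FinP.¬∀⟶∃¬ m _ P? ¬all
... | i , ¬p = <-≤-trans (sum-mono-< (λ j → ⟦⟧≤1 (P? j)) i (s≤s (≤-reflexive (⟦⟧-no (P? i) ¬p))))
                         (≤-reflexive (trans (sum-const m 1) (*-identityʳ m)))

count-pair : ∀ {n} {P : Fin n → Set} (P? : ∀ i → Dec (P i)) (a b : Fin n) →
             (∀ i → P i → i ≡ a ⊎ i ≡ b) → sum (λ i → ⟦ P? i ⟧) ≤ 2
count-pair {n} P? a b P⇒ab = begin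
  sum (λ i → ⟦ P? i ⟧)                                        ≤⟨ sum-mono-≤ le ⟩
  sum (λ i → ⟦ a ≟ i ⟧ * 1 + ⟦ b ≟ i ⟧ * 1) ≡⟨ ∑-distrib-+ (λ i → ⟦ a ≟ i ⟧ * 1) (λ i → ⟦ b ≟ i ⟧ * 1) ⟩
  sum (λ i → ⟦ a ≟ i ⟧ * 1) + sum (λ i → ⟦ b ≟ i ⟧ * 1)  ≡⟨ cong₂ _+_ (sum-δ a (λ _ → 1)) (sum-δ b (λ _ → 1)) ⟩
  2                                                            ∎
  where
  open ≤-Reasoning
  le : ∀ i → ⟦ P? i ⟧ ≤ ⟦ a ≟ i ⟧ * 1 + ⟦ b ≟ i ⟧ * 1
  le i with P? i
  ... | no  _ = z≤n
  ... | yes p with P⇒ab i p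
  ...   | inj₁ refl = ≤-trans (≤-reflexive (sym (trans (*-identityʳ _) (⟦⟧-yes (i ≟ i) refl)))) (m≤m+n _ _)
  ...   | inj₂ refl = ≤-trans (≤-reflexive (sym (trans (*-identityʳ _) (⟦⟧-yes (i ≟ i) refl))))
      (m≤n+m _ (⟦ a ≟ i ⟧ * 1))

⟦⟧-exclusive : ∀ {P Q : Set} (P? : Dec P) (Q? : Dec Q) → (P → ¬ Q) → ⟦ P? ⟧ + ⟦ Q? ⟧ ≤ 1
⟦⟧-exclusive (yes p) Q? P⇒¬Q = ≤-reflexive (cong suc (⟦⟧-no Q? (P⇒¬Q p)))
⟦⟧-exclusive (no _)  Q? P⇒¬Q = ⟦⟧≤1 Q?

⟦⟧-¬ : ∀ {P : Set} (P? : Dec P) → ⟦ P? ⟧ + ⟦ ¬? P? ⟧ ≡ 1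
⟦⟧-¬ (yes _) = refl
⟦⟧-¬ (no _)  = refl

⟦⟧-× : ∀ {P Q : Set} (P? : Dec P) (Q? : Dec Q) → ⟦ P? ⟧ * ⟦ Q? ⟧ ≡ ⟦ P? ×-dec Q? ⟧
⟦⟧-× (yes _) Q? = +-identityʳ _
⟦⟧-× (no _)  Q? = refl

count-injection : ∀ {m n} {P : Fin m → Set} (P? : ∀ i → Dec (P i)) {Q : Fin n → Set} (Q? : ∀ j → Dec (Q j))
                  (g : Fin m → Fin n) → (∀ {i} → P i → Q (g i)) → (∀ {i j} → P i → P j → g i ≡ g j → i ≡ j) →
                  sum (λ i → ⟦ P? i ⟧) ≤ sum (λ j → ⟦ Q? j ⟧)
count-injection P? Q? g P⇒Q g-inj = begin
  sum (λ i → ⟦ P? i ⟧)                                ≡⟨ sum-fibres g (λ i → ⟦ P? i ⟧) ⟨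
  sum (λ j → sum (λ i → ⟦ g i ≟ j ⟧ * ⟦ P? i ⟧))     ≤⟨ sum-mono-≤ fibre ⟩
  sum (λ j → ⟦ Q? j ⟧)                                ∎
  where
  open ≤-Reasoning
  fibre : ∀ j → sum (λ i → ⟦ g i ≟ j ⟧ * ⟦ P? i ⟧) ≤ ⟦ Q? j ⟧
  fibre j with FinP.any? (λ i → (g i ≟ j) ×-dec P? i)
  ... | no ∄ = ≤-trans (≤-reflexive (sum-zero λ i →
      trans (⟦⟧-× (g i ≟ j) (P? i)) (⟦⟧-no ((g i ≟ j) ×-dec P? i) λ p → ∄ (i , p)))) z≤n
  ... | yes (k , refl , p) = begin
    sum (λ i → ⟦ g i ≟ g k ⟧ * ⟦ P? i ⟧)   ≤⟨ sum-mono-≤ (λ i → ≤-trans (≤-reflexive (⟦⟧-× (g i ≟ g k) (P? i)))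
                                                  (⟦⟧-mono ((g i ≟ g k) ×-dec P? i) (k ≟ i) λ (e , q) →
                                                      g-inj p q (sym e))) ⟩
    sum (λ i → ⟦ k ≟ i ⟧)                  ≡⟨ sum-cong-≗ (λ i → *-identityʳ ⟦ k ≟ i ⟧) ⟨
    sum (λ i → ⟦ k ≟ i ⟧ * 1)              ≡⟨ sum-δ k (λ _ → 1) ⟩
    1                                      ≡⟨ ⟦⟧-yes (Q? (g k)) (P⇒Q p) ⟨
    ⟦ Q? (g k) ⟧                           ∎

-- Meant for `g` the reversal of darts: a class that contains nothing beyond a dart and its reversal
-- has at most two elements.
count-fibres : ∀ {m k} {P : Fin m → Set} (P? : ∀ i → Dec (P i)) (φ : Fin m → Fin k) (g : Fin m → Fin m) →
               (∀ {d e} → P d → P e → φ d ≡ φ e → e ≡ d ⊎ e ≡ g d) → sum (λ d → ⟦ P? d ⟧) ≤ 2 * k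
count-fibres {m} {k} P? φ g pair = begin
  sum (λ d → ⟦ P? d ⟧)                                   ≡⟨ sum-fibres φ (λ d → ⟦ P? d ⟧) ⟨
  sum (λ i → sum (λ d → ⟦ φ d ≟ i ⟧ * ⟦ P? d ⟧))        ≡⟨ sum-cong-≗ (λ i → sum-cong-≗ λ d →
      ⟦⟧-× (φ d ≟ i) (P? d)) ⟩
  sum (λ i → sum (λ d → ⟦ (φ d ≟ i) ×-dec P? d ⟧))      ≤⟨ sum-mono-≤ fibre ⟩
  sum {k} (λ _ → 2)                                       ≡⟨ sum-const k 2 ⟩
  k * 2                                                   ≡⟨ *-comm k 2 ⟩
  2 * k                                                   ∎
  where
  open ≤-Reasoning
  fibre : ∀ i → sum (λ d → ⟦ (φ d ≟ i) ×-dec P? d ⟧) ≤ 2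
  fibre i with FinP.any? (λ d → (φ d ≟ i) ×-dec P? d)
  ... | no ∄ = ≤-trans (≤-reflexive (sum-zero λ d → ⟦⟧-no ((φ d ≟ i) ×-dec P? d) λ p → ∄ (d , p))) z≤n
  ... | yes (d , refl , p) = count-pair (λ e → (φ e ≟ φ d) ×-dec P? e) d (g d) λ e (φe≡φd , q) →
      pair p q (sym φe≡φd)

-- Iteration, generated equivalences and transpositions

iter : ∀ {A : Set} → (A → A) → ℕ → A → A
iter f zero    x = x
iter f (suc k) x = f (iter f k x)

iter-+ : ∀ {A : Set} (f : A → A) j k x → iter f (j + k) x ≡ iter f j (iter f k x)
iter-+ f zero    k x = refl
iter-+ f (suc j) k x = cong f (iter-+ f j k x)

iter-injective : ∀ {A : Set} {f : A → A} → Injective _≡_ _≡_ f → ∀ k → Injective _≡_ _≡_ (iter f k)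
iter-injective f-inj zero    e = e
iter-injective f-inj (suc k) e = iter-injective f-inj k (f-inj e)

-- For injective `f` this says that the orbit of `x` has at least `m` points. A lower bound on the
-- length of a face is all that discharging needs.
Aperiodic : ∀ {A : Set} → (A → A) → ℕ → A → Set
Aperiodic f m x = ∀ k → suc k < m → iter f (suc k) x ≢ x

iter-distinct : ∀ {A : Set} {f : A → A} → Injective _≡_ _≡_ f → ∀ {m x} → Aperiodic f m x →
                Injective _≡_ _≡_ (λ (i : Fin m) → iter f (toℕ i) x)
iter-distinct {f = f} f-inj {m} {x} aperiodic {i} {j} e = FinP.toℕ-injective (compare (<-cmp (toℕ i) (toℕ j)))
  where
  shorter : ∀ {a b} → a < b → b < m → iter f a x ≢ iter f b x
  shorter {a} {b} a<b b<m e with m≤n⇒∃[o]m+o≡n a<b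
  ... | o , refl = aperiodic o (≤-<-trans (s≤s (m≤n+m o a)) b<m)
    (sym (iter-injective f-inj a (trans e
        (trans (cong (λ k → iter f k x) (sym (+-suc a o))) (iter-+ f a (suc o) x)))))
  compare : Tri _ _ _ → _
  compare (tri≈ _ i≡j _) = i≡j
  compare (tri< i<j _ _) = ⊥-elim (shorter i<j (FinP.toℕ<n j) e)
  compare (tri> _ _ j<i) = ⊥-elim (shorter j<i (FinP.toℕ<n i) (sym e))

period : ∀ {n} {f : Fin n → Fin n} → Injective _≡_ _≡_ f → ∀ x → ∃ λ m → iter f (suc m) x ≡ x
period {n} {f} f-inj x with FinP.pigeonhole (n<1+n n) (λ i → iter f (toℕ i) x)
... | i , j , i<j , e with m≤n⇒∃[o]m+o≡n i<j
...   | o , p = o , sym (iter-injective f-inj (toℕ i)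
        (trans e (trans (cong (λ k → iter f k x) (sym (trans (+-suc (toℕ i) o) p)))
            (iter-+ f (toℕ i) (suc o) x))))

Link : ∀ {A : Set} → (A → A) → Rel A 0ℓ
Link f x y = f x ≡ y

invariant : ∀ {A B : Set} {R : Rel A 0ℓ} (h : A → B) → (∀ {x y} → R x y → h x ≡ h y) →
            ∀ {x y} → EqClosure R x y → h x ≡ h y
invariant h = EqC.gfold isEquivalence h

-- The tool for computing a class explicitly: exhibit a set that contains one of its points and is
-- closed under `R` in both directions. Implication both ways is an equivalence relation on `Set`,
-- so the generated equivalence folds into it.
closed : ∀ {A : Set} {R : Rel A 0ℓ} (P : A → Set) → (∀ {x y} → R x y → P x → P y) →
    (∀ {x y} → R x y → P y → P x) →
         ∀ {x y} → EqClosure R x y → P x → P y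
closed P fwd bwd xy = proj₁ (EqC.gfold {S = λ A B → (A → B) × (B → A)}
  (record { refl = id , id ; sym = λ (f , g) → g , f ; trans = λ (f , g) (h , k) → h ∘ f , g ∘ k })
  P (λ r → fwd r , bwd r) xy)

transpose-left : ∀ {n} (x y : Fin n) → transpose x y x ≡ y
transpose-left x y rewrite dec-true (x ≟ x) refl = refl

transpose-right : ∀ {n} (x y : Fin n) → transpose x y y ≡ x
transpose-right x y with y ≟ x
... | yes refl = refl
... | no  _    rewrite dec-true (y ≟ y) refl = refl

transpose-other : ∀ {n} {x y z : Fin n} → z ≢ x → z ≢ y → transpose x y z ≡ z
transpose-other {x = x} {y} {z} z≢x z≢y rewrite dec-false (z ≟ x) z≢x | dec-false (z ≟ y) z≢y = refl

transpose-involutive : ∀ {n} (x y z : Fin n) → transpose x y (transpose x y z) ≡ z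
transpose-involutive x y z with z ≟ x
... | yes refl = transpose-right x y
... | no z≢x with z ≟ y
...   | yes refl = transpose-left x y
...   | no z≢y = transpose-other z≢x z≢y

transpose-injective : ∀ {n} (x y : Fin n) → Injective _≡_ _≡_ (transpose x y)
transpose-injective x y e = trans (sym (transpose-involutive x y _))
    (trans (cong (transpose x y) e) (transpose-involutive x y _))

transpose-invariant : ∀ {n} {B : Set} (h : Fin n → B) {x y} → h x ≡ h y → ∀ z → h (transpose x y z) ≡ h z
transpose-invariant h {x} {y} e z with z ≟ x
... | yes refl = sym e
... | no _ with z ≟ y
...   | yes refl = e
...   | no _ = refl

-- Follow f from x until it first returns to {x , y}: composing with the transposition
-- sends that last step to the other of the two points.
transpose-orbits : ∀ {n} {f : Fin n → Fin n} → Injective _≡_ _≡_ f → ∀ x y →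
  EqClosure (Link (transpose x y ∘ f)) x y ⊎ EqClosure (Link f) x y
transpose-orbits {n} {f} f-inj x y = [ id , return-to-x ]′ (agree (proj₁ (period f-inj x)))
  where
  f′ = transpose x y ∘ f
  agree : ∀ k → (EqClosure (Link f′) x y ⊎ EqClosure (Link f) x y) ⊎
      (EqClosure (Link f′) x (iter f k x) × EqClosure (Link f) x (iter f k x))
  agree zero = inj₂ (EqC.reflexive _ , EqC.reflexive _)
  agree (suc k) with agree k
  ... | inj₁ done = inj₁ done
  ... | inj₂ (p′ , p) with f (iter f k x) ≟ x
  ...   | yes e = inj₁ (inj₁ (EqC.transitive _ p′
      (EqC.return (trans (cong (transpose x y) e) (transpose-left x y)))))
  ...   | no ≢x with f (iter f k x) ≟ y
  ...     | yes e = inj₁ (inj₂ (EqC.transitive _ p (EqC.return e)))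
  ...     | no ≢y = inj₂ (EqC.transitive _ p′ (EqC.return (transpose-other ≢x ≢y)) , EqC.transitive _ p
      (EqC.return refl))
  return-to-x : _ → _
  return-to-x (p′ , _) = inj₁ (EqC.transitive _ p′ (EqC.return
    (trans (cong (transpose x y) (proj₂ (period f-inj x))) (transpose-left x y))))

-- Combinatorial maps

module _ {N : ℕ} where

  -- A lower bound of k on the number of orbits of f.
  record OrbitColouring (f : Fin N → Fin N) (k : ℕ) : Set where
    field
      colour        : Fin N → Fin k
      colour-step   : ∀ d → colour (f d) ≡ colour d
      colour-onto   : ∀ i → ∃ λ d → colour d ≡ i

    colour-orbit : ∀ {d e} → EqClosure (Link f) d e → colour d ≡ colour e
    colour-orbit = invariant colour λ { refl → sym (colour-step _) }

  -- An upper bound of k on the number of classes of R.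
  record ClassLabelling (R : Rel (Fin N) 0ℓ) (k : ℕ) : Set where
    field
      label         : Fin N → Fin k
      label-classes : ∀ {d e} → label d ≡ label e → EqClosure R d e

  open OrbitColouring
  open ClassLabelling

  module _ {f : Fin N → Fin N} {k : ℕ} (x y : Fin N) (φ : OrbitColouring f k) where
    private f′ = transpose x y ∘ f

    -- Composition with the transposition redirects steps only between `x` and `y`, so the colouring
    -- survives as soon as these two have the same colour. If they have not, the colour of `x` is
    -- deleted and its points take the colour of `y`, at the cost of one colour.
    merge-orbits : ∃ λ k′ → k ≤ suc k′ × OrbitColouring f′ k′
    merge-orbits = merge φ (colour φ x ≟ colour φ y)
      where
      merge : ∀ {k} (φ : OrbitColouring f k) → Dec (colour φ x ≡ colour φ y) →
              ∃ λ k′ → k ≤ suc k′ × OrbitColouring f′ k′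
      merge {k} φ (yes φx≡φy) = k , n≤1+n k , record
        { colour      = colour φ
        ; colour-step = λ d → trans (transpose-invariant (colour φ) φx≡φy (f d)) (colour-step φ d)
        ; colour-onto = colour-onto φ
        }
      merge {zero}  φ (no φx≢φy) with () ← colour φ x
      merge {suc k} φ (no φx≢φy) = k , ≤-refl , record
        { colour      = λ d → collapse (colour φ d)
        ; colour-step = λ d → trans (transpose-invariant (collapse ∘ colour φ) collapse-xy (f d))
            (cong collapse (colour-step φ d))
        ; colour-onto = onto
        }
        where
        collapse : Fin (suc k) → Fin k
        collapse i with colour φ x ≟ i
        ... | yes _ = punchOut φx≢φy
        ... | no ≢i = punchOut ≢i
        collapse-xy : collapse (colour φ x) ≡ collapse (colour φ y)
        collapse-xy with colour φ x ≟ colour φ x | colour φ x ≟ colour φ y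
        ... | no ≢ | _ = contradiction refl ≢
        ... | yes _ | yes e = contradiction e φx≢φy
        ... | yes _ | no _ = FinP.punchOut-cong (colour φ x) refl
        collapse-punchIn : ∀ i → collapse (punchIn (colour φ x) i) ≡ i
        collapse-punchIn i with colour φ x ≟ punchIn (colour φ x) i
        ... | yes e = contradiction (sym e) (FinP.punchInᵢ≢i _ i)
        ... | no _  = trans (FinP.punchOut-cong (colour φ x) refl) (FinP.punchOut-punchIn (colour φ x))
        onto : ∀ i → ∃ λ d → collapse (colour φ d) ≡ i
        onto i with colour-onto φ (punchIn (colour φ x) i)
        ... | d , e = d , trans (cong collapse e) (collapse-punchIn i)

    -- The orbit of `x` gets a new colour. Every old colour still occurs: if a witness for it lies
    -- in the orbit of `x`, then the colour is that of `y`, which lies outside this orbit.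
    split-orbit : colour φ x ≡ colour φ y → ¬ EqClosure (Link f′) x y → (∀ d → Dec (EqClosure (Link f′) x d)) →
                  OrbitColouring f′ (suc k)
    split-orbit φx≡φy x≁y orbit? = record { colour = new ; colour-step = step ; colour-onto = onto }
      where
      old-step : ∀ d → colour φ (f′ d) ≡ colour φ d
      old-step d = trans (transpose-invariant (colour φ) φx≡φy (f d)) (colour-step φ d)
      new : Fin N → Fin (suc k)
      new d with orbit? d
      ... | yes _ = zero
      ... | no _  = suc (colour φ d)
      step : ∀ d → new (f′ d) ≡ new d
      step d with orbit? d | orbit? (f′ d)
      ... | yes _ | yes _ = refl
      ... | no _  | no _  = cong suc (old-step d)
      ... | yes p | no ¬p = contradiction (EqC.transitive _ p (EqC.return refl)) ¬p
      ... | no ¬p | yes p = contradiction (EqC.transitive _ p (EqC.symmetric _ (EqC.return refl))) ¬p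
      new-off : ∀ {d} → ¬ EqClosure (Link f′) x d → new d ≡ suc (colour φ d)
      new-off {d} ¬p with orbit? d
      ... | yes p = contradiction p ¬p
      ... | no _  = refl
      onto : ∀ i → ∃ λ d → new d ≡ i
      onto zero = x , x-new
        where
        x-new : new x ≡ zero
        x-new with orbit? x
        ... | yes _ = refl
        ... | no ¬p = contradiction (EqC.reflexive _) ¬p
      onto (suc i) with colour-onto φ i
      ... | d , refl with orbit? d
      ...   | no ¬p = d , new-off ¬p
      ...   | yes p = y , trans (new-off x≁y)
          (cong suc (trans (sym φx≡φy) (invariant (colour φ) (λ { refl → sym (old-step _) }) p)))

  -- S is allowed to lose from R only links that follow from x ~ y.
  module _ {R S : Rel (Fin N) 0ℓ} {k : ℕ} {x y : Fin N} (λR : ClassLabelling R k)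
           (links : ∀ {d e} → R d e → EqClosure S d e ⊎ (EqClosure S d x × EqClosure S y e) ⊎
               (EqClosure S d y × EqClosure S x e)) where

    keep-class : EqClosure S x y → ClassLabelling S k
    keep-class x~y = record { label = label λR ; label-classes = λ e → (relink EqC.⋆) (label-classes λR e) }
      where
      relink : ∀ {d e} → R d e → EqClosure S d e
      relink r with links r
      ... | inj₁ p = p
      ... | inj₂ (inj₁ (p , q)) = EqC.transitive _ p (EqC.transitive _ x~y q)
      ... | inj₂ (inj₂ (p , q)) = EqC.transitive _ p (EqC.transitive _ (EqC.symmetric _ x~y) q)

    -- Without the link between `x` and `y`, a class falls apart into at most the class of `x` and
    -- the class of `y`. A new label on the former tells them apart.
    split-class : (∀ d → Dec (EqClosure S x d)) → ClassLabelling S (suc k)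
    split-class class? = record { label = new ; label-classes = classes }
      where
      _~_ = EqClosure S
      -- The equivalence generated by S together with the link x ~ y.
      _≋_ : Rel (Fin N) 0ℓ
      d ≋ e = (x ~ d ⊎ y ~ d) × (x ~ e ⊎ y ~ e) ⊎ d ~ e
      close : ∀ {d e} → EqClosure R d e → d ≋ e
      close = EqC.fold (record { refl = inj₂ (EqC.reflexive _) ; sym = ≋-sym ; trans = ≋-trans }) link
        where
        ≋-sym : ∀ {d e} → d ≋ e → e ≋ d
        ≋-sym (inj₁ (p , q)) = inj₁ (q , p)
        ≋-sym (inj₂ p) = inj₂ (EqC.symmetric _ p)
        push : ∀ {d e} → x ~ d ⊎ y ~ d → d ~ e → x ~ e ⊎ y ~ e
        push (inj₁ p) q = inj₁ (EqC.transitive _ p q)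
        push (inj₂ p) q = inj₂ (EqC.transitive _ p q)
        ≋-trans : ∀ {a b c} → a ≋ b → b ≋ c → a ≋ c
        ≋-trans (inj₁ (p , _)) (inj₁ (_ , q)) = inj₁ (p , q)
        ≋-trans (inj₁ (p , q)) (inj₂ r) = inj₁ (p , push q r)
        ≋-trans (inj₂ r) (inj₁ (p , q)) = inj₁ (push p (EqC.symmetric _ r) , q)
        ≋-trans (inj₂ p) (inj₂ q) = inj₂ (EqC.transitive _ p q)
        link : ∀ {d e} → R d e → d ≋ e
        link r with links r
        ... | inj₁ p = inj₂ p
        ... | inj₂ (inj₁ (p , q)) = inj₁ (inj₁ (EqC.symmetric _ p) , inj₂ q)
        ... | inj₂ (inj₂ (p , q)) = inj₁ (inj₂ (EqC.symmetric _ p) , inj₁ q)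
      new : Fin N → Fin (suc k)
      new d with class? d
      ... | yes _ = zero
      ... | no _  = suc (label λR d)
      classes : ∀ {d e} → new d ≡ new e → d ~ e
      classes {d} {e} eq with class? d | class? e
      ... | yes p | yes q = EqC.transitive _ (EqC.symmetric _ p) q
      ... | no ¬p | no ¬q with close (label-classes λR (FinP.suc-injective eq))
      ...   | inj₂ r = r
      ...   | inj₁ (inj₁ p , _) = contradiction p ¬p
      ...   | inj₁ (_ , inj₁ q) = contradiction q ¬q
      ...   | inj₁ (inj₂ p , inj₂ q) = EqC.transitive _ (EqC.symmetric _ p) q

module Maps {n N : ℕ} (src : Fin N → Fin n) (α : Fin N → Fin N) (αα : ∀ d → α (α d) ≡ d) where

  Connect : (Fin N → Fin N) → Rel (Fin N) 0ℓ
  Connect σ d e = σ d ≡ e ⊎ α d ≡ e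

  -- A map on the darts Fin N in which the darts of X have been detached from
  -- their vertices, and now are the only darts at a vertex of their own.
  record DetachedMap (X : List (Fin N)) : Set where
    field
      σ           : Fin N → Fin N
      σ-injective : Injective _≡_ _≡_ σ
      σ-source    : ∀ d → src (σ d) ≡ src d
      σ-detached  : ∀ {d} → d ∈ X → σ d ≡ d
      σ-attached  : ∀ {d e} → d ∉ X → e ∉ X → src d ≡ src e → EqClosure (Link σ) d e
      {V F C}     : ℕ
      vertices    : OrbitColouring σ V
      faces       : OrbitColouring (σ ∘ α) F
      components  : ClassLabelling (Connect σ) C
      -- The inequality E + 2C ≤ V + F doubled, since `N` counts darts rather than edges. Each of
      -- the three numbers errs on the side that makes this imply the inequality for the true
      -- counts.
      euler       : N + 4 * C ≤ 2 * (V + F)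

  α-injective : Injective _≡_ _≡_ α
  α-injective e = trans (sym (αα _)) (trans (cong α e) (αα _))

  module _ {X : List (Fin N)} (M : DetachedMap X) {x : Fin N} where
    open DetachedMap M
    open OrbitColouring

    private
      y  = σ x
      -- This cuts `x` out of its cycle: `x` becomes a fixed point, and its predecessor now goes to
      -- `σ x`.
      σ′ = transpose x y ∘ σ
      f′ = σ′ ∘ α
      _~_ = EqClosure (Link σ′)

      σ′-injective : Injective _≡_ _≡_ σ′
      σ′-injective = σ-injective ∘ transpose-injective x y

      σ′-detached : ∀ {d} → y ≢ x → d ∈ x ∷ X → σ′ d ≡ d
      σ′-detached y≢x (here refl) = transpose-right x y
      σ′-detached {d} y≢x (there d∈X) with d ≟ x
      ... | yes refl = transpose-right x y
      ... | no d≢x   = trans (cong (transpose x y) σd≡d)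
        (transpose-other d≢x λ d≡σx → d≢x (σ-injective (trans σd≡d d≡σx)))
        where σd≡d = σ-detached d∈X

      σ′-attached : ∀ {d e} → y ≢ x → d ∉ x ∷ X → e ∉ x ∷ X → src d ≡ src e → d ~ e
      σ′-attached {d} {e} y≢x d∉ e∉ s = subst₂ _~_ (bypass-≢ (d∉ ∘ here)) (bypass-≢ (e∉ ∘ here))
        (EqC.gfold (EqC.isEquivalence _) bypass link (σ-attached (d∉ ∘ there) (e∉ ∘ there) s))
        where
        -- Reading `x` as its successor `y` turns a path of `σ` through `x` into a path of `σ′`
        -- around it.
        bypass : Fin N → Fin N
        bypass d with d ≟ x
        ... | yes _ = y
        ... | no _  = d
        bypass-≢ : ∀ {d} → d ≢ x → bypass d ≡ d
        bypass-≢ {d} d≢x with d ≟ x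
        ... | yes e = contradiction e d≢x
        ... | no _  = refl
        link : ∀ {d e} → σ d ≡ e → bypass d ~ bypass e
        link {d} refl with d ≟ x
        ... | yes refl = subst (y ~_) (sym (bypass-≢ y≢x)) (EqC.reflexive _)
        ... | no d≢x with σ d ≟ x
        ...   | yes σd≡x = EqC.return (trans (cong (transpose x y) σd≡x) (transpose-left x y))
        ...   | no σd≢x  = EqC.return (transpose-other σd≢x (d≢x ∘ σ-injective))

      isolated : ∀ {d} → x ~ d → x ≡ d
      isolated p = closed (x ≡_) (λ { refl refl → sym (transpose-right x y) })
        (λ { refl x≡σ′d → σ′-injective (trans (transpose-right x y) x≡σ′d) }) p refl

      split-vertex : y ≢ x → OrbitColouring σ′ (suc V)
      split-vertex y≢x = split-orbit x y vertices (sym (colour-step vertices x)) (y≢x ∘ sym ∘ isolated)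
        (λ d → map′ (λ { refl → EqC.reflexive _ }) isolated (x ≟ d))

      links : ∀ {d e} → Connect σ d e → let _≋_ = EqClosure (Connect σ′) in
              d ≋ e ⊎ (d ≋ x × y ≋ e) ⊎ (d ≋ y × x ≋ e)
      links (inj₂ p) = inj₁ (EqC.return (inj₂ p))
      links {d} (inj₁ refl) with σ d ≟ x
      ... | yes σd≡x = inj₂ (inj₂ (EqC.return (inj₁ (trans (cong (transpose x y) σd≡x) (transpose-left x y))) ,
                                  EqC.symmetric _ (subst (λ z → EqClosure (Connect σ′) z x) (sym σd≡x)
                                      (EqC.reflexive _))))
      ... | no σd≢x with σ d ≟ y
      ...   | yes σd≡y = inj₂ (inj₁ (EqC.return
          (inj₁ (trans (cong (transpose x y) σd≡y) (transpose-right x y))) ,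
                                  EqC.symmetric _ (subst (λ z → EqClosure (Connect σ′) z y) (sym σd≡y)
                                      (EqC.reflexive _))))
      ...   | no σd≢y  = inj₁ (EqC.return (inj₁ (transpose-other σd≢x σd≢y)))

      detached-map : y ≢ x → ∀ {F′ C′} → OrbitColouring f′ F′ → ClassLabelling (Connect σ′) C′ →
                     N + 4 * C′ ≤ 2 * (suc V + F′) → DetachedMap (x ∷ X)
      detached-map y≢x φ λ′ euler′ = record
        { σ           = σ′
        ; σ-injective = σ′-injective
        ; σ-source    = λ d → trans (transpose-invariant src (sym (σ-source x)) (σ d)) (σ-source d)
        ; σ-detached  = σ′-detached y≢x
        ; σ-attached  = σ′-attached y≢x
        ; vertices    = split-vertex y≢x
        ; faces       = φ
        ; components  = λ′
        ; euler       = euler′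
        }

      -- A facial walk stays in one component. So if `x` and `σ x` lie on a common face after the
      -- detachment, no component has been cut.
      f-step⇒connected : ∀ {d e} → Link f′ d e → EqClosure (Connect σ′) d e
      f-step⇒connected refl = EqC.transitive _ (EqC.return (inj₂ refl)) (EqC.return (inj₁ refl))

    -- Detaching x composes σ, and hence the face permutation, with the transposition of
    -- x and σ x.  If this merges two faces, no component is cut; if it splits a face,
    -- then at most one component is cut.
    detach : ¬ ¬ DetachedMap (x ∷ X)
    detach with y ≟ x
    ... | yes y≡x = return record
      { σ           = σ
      ; σ-injective = σ-injective
      ; σ-source    = σ-source
      ; σ-detached  = λ { (here refl) → y≡x ; (there d∈X) → σ-detached d∈X }
      ; σ-attached  = λ d∉ e∉ → σ-attached (d∉ ∘ there) (e∉ ∘ there)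
      ; vertices    = vertices
      ; faces       = faces
      ; components  = components
      ; euler       = euler
      }
    ... | no y≢x = ¬¬-excluded-middle {A = EqClosure (Link f′) x y} >>= cases
      where
      cases : Dec (EqClosure (Link f′) x y) → ¬ ¬ DetachedMap (x ∷ X)
      cases (yes x~y) with merge-orbits x y faces
      ... | F′ , F≤1+F′ , φ = return (detached-map y≢x φ
          (keep-class components links ((f-step⇒connected EqC.⋆) x~y)) (begin
        N + 4 * C             ≤⟨ euler ⟩
        2 * (V + F)           ≤⟨ *-monoʳ-≤ 2 (+-monoʳ-≤ V F≤1+F′) ⟩
        2 * (V + suc F′)      ≡⟨ cong (2 *_) (+-suc V F′) ⟩
        2 * (suc V + F′)      ∎))
        where open ≤-Reasoning
      cases (no x≁y) = ¬¬-Fin (λ d → ¬¬-excluded-middle {A = EqClosure (Link f′) x d}) >>= λ orbit? →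
                       ¬¬-Fin (λ d → ¬¬-excluded-middle {A = EqClosure (Connect σ′) x d}) >>= λ class? →
        return (detached-map y≢x
          (split-orbit x y faces φx≡φy x≁y orbit?)
          (split-class components links class?)
          (begin
            N + 4 * suc C           ≡⟨ lhs N C ⟩
            4 + (N + 4 * C)         ≤⟨ +-monoʳ-≤ 4 euler ⟩
            4 + 2 * (V + F)         ≡⟨ rhs V F ⟩
            2 * (suc V + suc F)     ∎))
        where
        open ≤-Reasoning
        φx≡φy : colour faces x ≡ colour faces y
        φx≡φy = [ (λ p → contradiction p x≁y) , colour-orbit faces ]′
            (transpose-orbits (α-injective ∘ σ-injective) x y)
        lhs : ∀ N C → N + 4 * suc C ≡ 4 + (N + 4 * C)
        lhs = solve-∀
        rhs : ∀ V F → 4 + 2 * (V + F) ≡ 2 * (suc V + suc F)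
        rhs = solve-∀

  detach-all : DetachedMap [] → ∀ X → ¬ ¬ DetachedMap X
  detach-all M []      = return M
  detach-all M (x ∷ X) = detach-all M X >>= λ M′ → detach M′

-- Dart numberings of graphs

lookup-injective : ∀ {A : Set} {xs : List A} → Unique xs → Injective _≡_ _≡_ (lookup xs)
lookup-injective (x∉ ∷ u) {zero}  {zero}  e = refl
lookup-injective (x∉ ∷ u) {zero}  {suc j} e = contradiction e (All.lookup x∉ (∈-lookup j))
lookup-injective (x∉ ∷ u) {suc i} {zero}  e = contradiction (sym e) (All.lookup x∉ (∈-lookup i))
lookup-injective (x∉ ∷ u) {suc i} {suc j} e = cong suc (lookup-injective u e)

module _ {n : ℕ} (G : Graph n) where
  open Graph G
  open Dart

  dart-ext : {d e : Dart G} → source d ≡ source e → target d ≡ target e → d ≡ e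
  dart-ext {dart u v p} {dart u v q} refl refl = cong (dart u v) (T-irrelevant p q)

  enumerate-darts : ∃ λ N → Dart G ↔ Fin N
  enumerate-darts = length pairs , mk↔ {to = to} {from = from}
    ( (λ { {i} refl → lookup-injective unique (sym (lookup-index (∈pairs (from i)))) })
    , (λ { {d} refl → dart-ext (cong proj₁ (sym (lookup-index (∈pairs d))))
        (cong proj₂ (sym (lookup-index (∈pairs d)))) }))
    where
    adj? : (p : Fin n × Fin n) → Dec (T (adj (proj₁ p) (proj₂ p)))
    adj? (u , v) = T? (adj u v)
    all-pairs = cartesianProduct (allFin n) (allFin n)
    pairs = filter adj? all-pairs
    unique : Unique pairs
    unique = filter⁺ adj? (cartesianProduct⁺ (allFin⁺ n) (allFin⁺ n))
    ∈pairs : (d : Dart G) → (source d , target d) ∈ pairs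
    ∈pairs (dart u v e) = ∈-filter⁺ adj? (∈-cartesianProduct⁺ (∈-allFin u) (∈-allFin v)) e
    to : Dart G → Fin (length pairs)
    to d = index (∈pairs d)
    from : Fin (length pairs) → Dart G
    from i = dart _ _ (proj₂ (∈-filter⁻ adj? {xs = all-pairs} (∈-lookup {xs = pairs} i)))

-- Darts are renamed as elements of `Fin N`, so that counting darts becomes summing over `Fin N` and
-- permutations act on a finite index set. Simplicity of the graph survives as `dart-unique`.
record DartSystem {n : ℕ} (G : Graph n) : Set where
  open Graph G
  field
    N               : ℕ
    src             : Fin N → Fin n
    α               : Fin N → Fin N
    α-involutive    : ∀ d → α (α d) ≡ d

  tgt : Fin N → Fin n
  tgt d = src (α d)

  field
    dart-unique     : ∀ {d e} → src d ≡ src e → tgt d ≡ tgt e → d ≡ e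
    dart-adjacent   : ∀ d → Adj (src d) (tgt d)
    dart-of         : ∀ {u v} → Adj u v → ∃ λ d → src d ≡ u × tgt d ≡ v

  dart-loopless : ∀ d → src d ≢ tgt d
  dart-loopless d s≡t = subst T (trans (cong (adj (src d)) (sym s≡t)) (adj-irrefl (src d))) (dart-adjacent d)

  open Maps src α α-involutive public

module Numbering {n : ℕ} (G : Graph n) {N : ℕ} (enumeration : Dart G ↔ Fin N) where
  open Graph G
  open Dart
  open Inverse enumeration using (to; from; strictlyInverseˡ; strictlyInverseʳ)

  src : Fin N → Fin n
  src d = source (from d)

  α : Fin N → Fin N
  α d = to (opposite G (from d))

  from-α : ∀ d → from (α d) ≡ opposite G (from d)
  from-α d = strictlyInverseʳ _

  α-involutive : ∀ d → α (α d) ≡ d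
  α-involutive d = begin
    to (opposite G (from (α d)))             ≡⟨ cong (to ∘ opposite G) (from-α d) ⟩
    to (opposite G (opposite G (from d)))    ≡⟨ cong to (dart-ext G refl refl) ⟩
    to (from d)                              ≡⟨ strictlyInverseˡ d ⟩
    d                                        ∎
    where open ≡-Reasoning

  tgt : Fin N → Fin n
  tgt d = src (α d)

  tgt≡target : ∀ d → tgt d ≡ target (from d)
  tgt≡target d = cong source (from-α d)

  dart-unique : ∀ {d e} → src d ≡ src e → tgt d ≡ tgt e → d ≡ e
  dart-unique {d} {e} s t = trans (sym (strictlyInverseˡ d)) (trans
    (cong to (dart-ext G s (trans (sym (tgt≡target d)) (trans t (tgt≡target e))))) (strictlyInverseˡ e))

  dart-adjacent : ∀ d → Adj (src d) (tgt d)
  dart-adjacent d = subst (Adj (src d)) (sym (tgt≡target d)) (edge (from d))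

  dart-of : ∀ {u v} → Adj u v → ∃ λ d → src d ≡ u × tgt d ≡ v
  dart-of e = to (dart _ _ e) , cong source (strictlyInverseʳ (dart _ _ e)) ,
    trans (tgt≡target _) (cong target (strictlyInverseʳ (dart _ _ e)))

  dart-system : DartSystem G
  dart-system = record
    { N = N ; src = src ; α = α ; α-involutive = α-involutive
    ; dart-unique = dart-unique ; dart-adjacent = dart-adjacent ; dart-of = dart-of }

  open Maps src α α-involutive

  orbit-colouring : ∀ {f : Dart G → Dart G} {g : Fin N → Fin N} {k} → (∀ d → from (g d) ≡ f (from d)) →
                    ClassCount (Step G f) k → OrbitColouring g k
  orbit-colouring conj count = record
    { colour      = λ d → class (from d)
    ; colour-step = λ d → trans (cong class (conj d)) (cong′ (EqC.symmetric _ (EqC.return refl)))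
    ; colour-onto = λ i → let (d , p) = surjective i in to d , trans (cong class (strictlyInverseʳ d)) (p (EqC.reflexive _))
    }
    where open Bijection count using (surjective) renaming (to to class; cong to cong′)

  twice-edges : ∀ {E} → ClassCount (Step G (opposite G)) E → N ≤ 2 * E
  twice-edges {E} count = begin
    N                                ≡⟨ *-identityʳ N ⟨
    N * 1                            ≡⟨ sum-const N 1 ⟨
    sum (λ d → ⟦ U? d ⟧)             ≤⟨ count-fibres U? (λ d → class (from d)) α (λ _ _ → same ∘ injective) ⟩
    2 * E                            ∎
    where
    open ≤-Reasoning
    open Bijection count using (injective) renaming (to to class)
    U? : (d : Fin N) → Dec ⊤
    U? _ = yes tt
    same : ∀ {d e} → EqClosure (Step G (opposite G)) (from d) (from e) → e ≡ d ⊎ e ≡ α d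
    same {d} {e} q with closed (λ d′ → d′ ≡ from d ⊎ d′ ≡ opposite G (from d))
      (λ { refl (inj₁ refl) → inj₂ refl ; refl (inj₂ refl) → inj₁ (dart-ext G refl refl) })
      (λ { refl (inj₁ p) → inj₂ (dart-ext G (cong target p) (cong source p))
         ; refl (inj₂ p) → inj₁ (dart-ext G (cong target p) (cong source p)) })
      q (inj₁ refl)
    ... | inj₁ p = inj₁ (trans (sym (strictlyInverseˡ e)) (trans (cong to p) (strictlyInverseˡ d)))
    ... | inj₂ p = inj₂ (trans (sym (strictlyInverseˡ e)) (cong to p))

  undetached-map : Planar G → DetachedMap []
  undetached-map (ρ , V , E , F , C , countV , countE , countF , countC , genus-zero) = record
    { σ           = σN
    ; σ-injective = λ e → trans (sym (strictlyInverseˡ _))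
        (trans (cong to (rotation-injective (to-injective e))) (strictlyInverseˡ _))
    ; σ-source    = λ d → trans (cong source (from-σ d)) (sym (Equivalence.to (orbits _ _) (EqC.return refl)))
    ; σ-detached  = λ ()
    ; σ-attached  = λ {d} {e} _ _ s → subst₂ (EqClosure (Link σN)) (strictlyInverseˡ d) (strictlyInverseˡ e)
                      (EqC.gmap to (λ { {d} refl → cong (to ∘ σ) (strictlyInverseʳ d) })
                          (Equivalence.from (orbits (from d) (from e)) s))
    ; vertices    = orbit-colouring from-σ countV
    ; faces       = orbit-colouring (λ d → trans (from-σ (α d)) (cong σ (from-α d))) countF
    ; components  = record
      { label         = λ d → component (from d)
      ; label-classes = λ {d} {e} p → subst₂ (EqClosure (Connect σN)) (strictlyInverseˡ d) (strictlyInverseˡ e)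
                      (EqC.gmap to connect (component-injective p)) }
    ; euler       = begin
        N + 4 * C              ≤⟨ +-monoˡ-≤ (4 * C) (twice-edges countE) ⟩
        2 * E + 4 * C          ≡⟨ arith E C ⟩
        2 * (E + 2 * C)        ≡⟨ cong (2 *_) genus-zero ⟨
        2 * (V + F)            ∎
    }
    where
    open ≤-Reasoning
    open RotationSystem ρ
    open Bijection countC using () renaming (to to component; injective to component-injective)
    σN : Fin N → Fin N
    σN d = to (σ (from d))
    from-σ : ∀ d → from (σN d) ≡ σ (from d)
    from-σ d = strictlyInverseʳ _
    to-injective : Injective _≡_ _≡_ to
    to-injective e = trans (sym (strictlyInverseʳ _)) (trans (cong from e) (strictlyInverseʳ _))
    rotation-injective : ∀ {d e} → σ (from d) ≡ σ (from e) → from d ≡ from e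
    rotation-injective e = trans (sym (Inverse.strictlyInverseʳ rotation _))
        (trans (cong (Inverse.from rotation) e) (Inverse.strictlyInverseʳ rotation _))
    connect : ∀ {d e} → Step G σ d e ⊎ Step G (opposite G) d e → Connect σN (to d) (to e)
    connect (inj₁ refl) = inj₁ (cong (to ∘ σ) (strictlyInverseʳ _))
    connect (inj₂ refl) = inj₂ (cong (to ∘ opposite G) (strictlyInverseʳ _))
    arith : ∀ E C → 2 * E + 4 * C ≡ 2 * (E + 2 * C)
    arith = solve-∀

planar-dart-system : ∀ {n} (G : Graph n) → Planar G → Σ (DartSystem G) λ Δ → DartSystem.DetachedMap Δ []
planar-dart-system G planar = let (_ , enumeration) = enumerate-darts G; open Numbering G enumeration in dart-system , undetached-map planar

-- Orientations with bounded outdegree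

module Orient {n : ℕ} where

  Arc = Fin n × Fin n

  within : (Fin n → Bool) → Arc → Bool
  within S (u , v) = S u ∧ S v

  size : (Fin n → Bool) → List Arc → ℕ
  size S []      = 0
  size S (a ∷ M) = ⟦ T? (within S a) ⟧ + size S M

  total : (Fin n → ℕ) → (Fin n → Bool) → ℕ
  total cap S = sum (λ u → ⟦ T? (S u) ⟧ * cap u)

  outdegree : Fin n → List Arc → ℕ
  outdegree u []            = 0
  outdegree u ((s , _) ∷ L) = ⟦ s ≟ u ⟧ + outdegree u L

  swap : Arc → Arc
  swap (u , v) = v , u

  -- Each arc of `L` is owned by its first component, and an arc of `M` may appear in `L` in either
  -- direction. The capacities vary with the vertex because they are used up one by one in the
  -- induction over `M`.
  Orientation : List Arc → (Fin n → ℕ) → Set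
  Orientation M cap = ∃ λ L → (∀ {a} → a ∈ M → a ∈ L ⊎ swap a ∈ L) × (∀ u → outdegree u L ≤ cap u)

  Sparse : List Arc → (Fin n → ℕ) → Set
  Sparse M cap = ∀ S → size S M ≤ total cap S

  Slack : List Arc → (Fin n → ℕ) → Fin n → Fin n → Set
  Slack M cap u v = ∀ S → T (S u) → ¬ T (S v) → size S M < total cap S

  ∪∩-bool : ∀ a b → ⟦ T? (a ∨ b) ⟧ + ⟦ T? (a ∧ b) ⟧ ≡ ⟦ T? a ⟧ + ⟦ T? b ⟧
  ∪∩-bool true  b = refl
  ∪∩-bool false b = +-identityʳ _

  -- This holds arc by arc: an arc inside one set lies inside the union, and an arc inside both sets
  -- lies inside the intersection as well. An arc between the two differences is counted on the
  -- right only.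
  size-supermodular : ∀ M S R → size S M + size R M ≤ size (λ u → S u ∨ R u) M + size (λ u → S u ∧ R u) M
  size-supermodular []            S R = z≤n
  size-supermodular ((u , v) ∷ M) S R = begin
    (a + size S M) + (b + size R M)  ≡⟨ interchange a (size S M) b (size R M) ⟩
    (a + b) + (size S M + size R M)  ≤⟨ +-mono-≤ (arc (S u) (S v) (R u) (R v)) (size-supermodular M S R) ⟩
    (c + d) + (size (λ u → S u ∨ R u) M + size (λ u → S u ∧ R u) M) ≡⟨ interchange c d
        (size (λ u → S u ∨ R u) M) _ ⟩
    (c + size (λ u → S u ∨ R u) M) + (d + size (λ u → S u ∧ R u) M) ∎
    where
    open ≤-Reasoning
    a = ⟦ T? (S u ∧ S v) ⟧
    b = ⟦ T? (R u ∧ R v) ⟧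
    c = ⟦ T? ((S u ∨ R u) ∧ (S v ∨ R v)) ⟧
    d = ⟦ T? ((S u ∧ R u) ∧ (S v ∧ R v)) ⟧
    interchange : ∀ a b c d → (a + b) + (c + d) ≡ (a + c) + (b + d)
    interchange = solve-∀
    arc : ∀ s s′ r r′ → ⟦ T? (s ∧ s′) ⟧ + ⟦ T? (r ∧ r′) ⟧ ≤ ⟦ T? ((s ∨ r) ∧ (s′ ∨ r′)) ⟧ + ⟦ T?
        ((s ∧ r) ∧ (s′ ∧ r′)) ⟧
    arc true  true  true  true  = ≤-refl
    arc true  true  true  false = ≤-refl
    arc true  true  false r′    = ≤-refl
    arc true  false true  true  = ≤-refl
    arc true  false true  false = z≤n
    arc true  false false r′    = z≤n
    arc false s′    true  true  rewrite ∨-zeroʳ s′ = s≤s z≤n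
    arc false s′    true  false = z≤n
    arc false s′    false r′    = z≤n

  total-modular : ∀ cap S R →
    total cap (λ u → S u ∨ R u) + total cap (λ u → S u ∧ R u) ≡ total cap S + total cap R
  total-modular cap S R = begin
    total cap (λ u → S u ∨ R u) + total cap (λ u → S u ∧ R u)
      ≡⟨ ∑-distrib-+ (λ u → ⟦ T? (S u ∨ R u) ⟧ * cap u) (λ u → ⟦ T? (S u ∧ R u) ⟧ * cap u) ⟨
    sum (λ u → ⟦ T? (S u ∨ R u) ⟧ * cap u + ⟦ T? (S u ∧ R u) ⟧ * cap u)
      ≡⟨ sum-cong-≗ (λ u → trans (sym (*-distribʳ-+ (cap u) ⟦ T? (S u ∨ R u) ⟧ _))
           (trans (cong (_* cap u) (∪∩-bool (S u) (R u))) (*-distribʳ-+ (cap u) ⟦ T? (S u) ⟧ _))) ⟩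
    sum (λ u → ⟦ T? (S u) ⟧ * cap u + ⟦ T? (R u) ⟧ * cap u)
      ≡⟨ ∑-distrib-+ (λ u → ⟦ T? (S u) ⟧ * cap u) (λ u → ⟦ T? (R u) ⟧ * cap u) ⟩
    total cap S + total cap R ∎
    where open ≡-Reasoning

  spend : (Fin n → ℕ) → Fin n → Fin n → ℕ
  spend cap u w = cap w ∸ ⟦ u ≟ w ⟧

  module _ {M : List Arc} {cap : Fin n → ℕ} {u v : Fin n} (slack : Slack M cap u v) (u≢v : u ≢ v) where

    -- Slack is applied to the set consisting of `u` alone. The result makes the truncated
    -- subtraction in `spend` exact.
    slack⇒positive : 1 ≤ cap u
    slack⇒positive = begin
      1                                          ≤⟨ s≤s z≤n ⟩
      suc (size (λ w → does (u ≟ w)) M)          ≤⟨ slack (λ w →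
          does (u ≟ w)) (subst T (sym (dec-true (u ≟ u) refl)) tt) (λ t → subst T (dec-false (u ≟ v) u≢v) t) ⟩
      total cap (λ w → does (u ≟ w))             ≡⟨ sum-δ u cap ⟩
      cap u                                      ∎
      where open ≤-Reasoning

    total-spend : ∀ S → total (spend cap u) S + ⟦ T? (S u) ⟧ ≡ total cap S
    total-spend S = begin
      total (spend cap u) S + ⟦ T? (S u) ⟧    ≡⟨ cong (total (spend cap u) S +_)
          (sum-δ u (λ w → ⟦ T? (S w) ⟧)) ⟨
      total (spend cap u) S + sum (λ w → ⟦ u ≟ w ⟧ * ⟦ T? (S w) ⟧)
        ≡⟨ ∑-distrib-+ (λ w → ⟦ T? (S w) ⟧ * spend cap u w) (λ w → ⟦ u ≟ w ⟧ * ⟦ T? (S w) ⟧) ⟨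
      sum (λ w → ⟦ T? (S w) ⟧ * spend cap u w + ⟦ u ≟ w ⟧ * ⟦ T? (S w) ⟧)
        ≡⟨ sum-cong-≗ (λ w → trans (cong (⟦ T? (S w) ⟧ * spend cap u w +_) (*-comm ⟦ u ≟ w ⟧ _))
             (trans (sym (*-distribˡ-+ ⟦ T? (S w) ⟧ (spend cap u w) _))
                 (cong (⟦ T? (S w) ⟧ *_) (m∸n+n≡m (unit w))))) ⟩
      total cap S ∎
      where
      open ≡-Reasoning
      unit : ∀ w → ⟦ u ≟ w ⟧ ≤ cap w
      unit w with u ≟ w
      ... | yes refl = slack⇒positive
      ... | no _     = z≤n

    private
      total-spend-at : ∀ S {b} → S u ≡ b → total (spend cap u) S + ⟦ T? b ⟧ ≡ total cap S
      total-spend-at S refl = total-spend S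

      drop-one : ∀ S → S u ≡ true → suc (size S M) ≤ total cap S → size S M ≤ total (spend cap u) S
      drop-one S Su le = +-cancelʳ-≤ 1 _ _
          (≤-trans (≤-reflexive (+-comm _ 1)) (≤-trans le (≤-reflexive (sym (total-spend-at S Su)))))

    -- A set without `u` keeps its capacity. A set with both ends can pay because it also had to pay
    -- for the arc just removed, and a set with `u` but not `v` can pay by its slack.
    spend-sparse : (∀ S → T (S u) → T (S v) → suc (size S M) ≤ total cap S) → Sparse M cap →
        Sparse M (spend cap u)
    spend-sparse both sparse S with S u in Su | S v in Sv
    ... | false | _     = ≤-trans (sparse S)
        (≤-reflexive (sym (trans (sym (+-identityʳ _)) (total-spend-at S Su))))
    ... | true  | true  = drop-one S Su (both S (subst T (sym Su) tt) (subst T (sym Sv) tt))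
    ... | true  | false = drop-one S Su (slack S (subst T (sym Su) tt) (subst T Sv))

    spend-orientation : ∀ {L} → (∀ w → outdegree w L ≤ spend cap u w) → ∀ w → outdegree w ((u , v) ∷ L) ≤ cap w
    spend-orientation out w with u ≟ w | out w
    ... | yes refl | o = ≤-trans (s≤s o) (≤-reflexive (trans (+-comm 1 _) (m∸n+n≡m slack⇒positive)))
    ... | no _     | o = o

  -- An edge u v can be charged to u unless some tight set contains u but not v.
  -- Tight sets of both kinds would violate sparsity in their union or intersection.
  orient : ∀ M cap → (∀ {u v} → (u , v) ∈ M → u ≢ v) → Sparse M cap → ¬ ¬ Orientation M cap
  orient []            cap loopless sparse = return ([] , (λ ()) , λ _ → z≤n)
  orient ((u , v) ∷ M) cap loopless sparse =
    ¬¬-excluded-middle {A = Slack M cap u v} >>= λ uv? → ¬¬-excluded-middle {A = Slack M cap v u} >>= λ vu? →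
        choose uv? vu?
    where
    u≢v : u ≢ v
    u≢v = loopless (here refl)
    tail : Sparse M cap
    tail S = ≤-trans (m≤n+m _ _) (sparse S)
    both : ∀ S → T (S u) → T (S v) → suc (size S M) ≤ total cap S
    both S Su Sv = ≤-trans (≤-reflexive
        (cong (_+ size S M) (sym (⟦⟧-yes (T? (S u ∧ S v)) (Equivalence.from T-∧ (Su , Sv)))))) (sparse S)
    choose : Dec (Slack M cap u v) → Dec (Slack M cap v u) → ¬ ¬ Orientation ((u , v) ∷ M) cap
    choose (yes slack) _ = orient M (spend cap u) (loopless ∘ there)
        (spend-sparse {M = M} slack u≢v both tail) >>= λ (L , covers , out) →
      return ((u , v) ∷ L , (λ { (here refl) → inj₁ (here refl) ; (there p) →
          [ inj₁ ∘ there , inj₂ ∘ there ]′ (covers p) }) , spend-orientation {M = M} slack u≢v {L} out)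
    choose (no _) (yes slack) = orient M (spend cap v) (loopless ∘ there)
        (spend-sparse {M = M} slack (u≢v ∘ sym) (λ S Sv Su → both S Su Sv) tail) >>= λ (L , covers , out) →
      return ((v , u) ∷ L , (λ { (here refl) → inj₂ (here refl) ; (there p) →
          [ inj₁ ∘ there , inj₂ ∘ there ]′ (covers p) }) , spend-orientation {M = M} slack (u≢v ∘ sym) {L} out)
    choose (no ¬uv) (no ¬vu) = ⊥-elim (¬uv λ S Su S∌v → decidable-stable (_ ℕ.<? _) λ S≮ → ¬vu λ R Rv R∌u →
        decidable-stable (_ ℕ.<? _) λ R≮ →
      n≮n _ (begin-strict
        total cap S + total cap R  ≤⟨ +-mono-≤ (≮⇒≥ S≮) (≮⇒≥ R≮) ⟩
        size S M + size R M        ≤⟨ size-supermodular M S R ⟩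
        size (λ w → S w ∨ R w) M + size (λ w → S w ∧ R w) M
          -- Strictness comes from the arc being charged: it has both ends in the union, so the
          -- union has a unit to spare for it over `M`.
          <⟨ +-mono-<-≤ (both (λ w → S w ∨ R w) (Equivalence.from T-∨ (inj₁ Su))
              (Equivalence.from T-∨ (inj₂ Rv))) (tail (λ w → S w ∧ R w)) ⟩
        total cap (λ w → S w ∨ R w) + total cap (λ w → S w ∧ R w) ≡⟨ total-modular cap S R ⟩
        total cap S + total cap R ∎))
      where open ≤-Reasoning

-- Colourings from orientations

fresh : ∀ {k} (xs : List (Fin k)) → length xs < k → ∃ λ i → i ∉ xs
fresh {k} xs short with FinP.any? (λ i → ¬? (i ∈? xs))
  where open DecMembership {A = Fin k} _≟_ using (_∈?_)
... | yes (i , i∉) = i , i∉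
... | no ∄ = ⊥-elim (clash (FinP.pigeonhole short (index ∘ member)))
  where
  open DecMembership {A = Fin k} _≟_ using (_∈?_)
  member : ∀ i → i ∈ xs
  member i = decidable-stable (i ∈? xs) λ i∉ → ∄ (i , i∉)
  clash : ¬ ∃₂ λ i j → i Fin.< j × index (member i) ≡ index (member j)
  clash (i , j , i<j , e) = <⇒≢ i<j (cong toℕ
    (trans (lookup-index (member i)) (trans (cong (lookup xs) e) (sym (lookup-index (member j))))))

module _ {n : ℕ} {G : Graph n} where
  open Graph G

  Valid : ∀ {k} → LocalPartition G k → (Fin n → Fin k) → Set
  Valid c φ = ∀ x y (e : Adj x y) → ¬ (φ x ≡ c x y e × φ y ≡ c y x (reverse-edge e))

  valid? : ∀ {k} (c : LocalPartition G k) φ → Dec (Valid c φ)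
  valid? c φ = FinP.all? λ x → FinP.all? λ y → edge? x y
    where
    edge? : ∀ x y → Dec ((e : Adj x y) → ¬ (φ x ≡ c x y e × φ y ≡ c y x (reverse-edge e)))
    edge? x y with T? (adj x y)
    ... | no ¬e = yes λ e → contradiction e ¬e
    ... | yes e = map′ (λ p e′ → subst (λ e →
        ¬ (φ x ≡ c x y e × φ y ≡ c y x (reverse-edge e))) (T-irrelevant e e′) p) (λ p → p e)
      (¬? ((φ x ≟ c x y e) ×-dec (φ y ≟ c y x (reverse-edge e))))

  conflict-colorable? : ∀ {k} (c : LocalPartition G k) → Dec (ConflictColorable G c)
  conflict-colorable? {k} c = map′ (λ (i , p) → finToFun i , p)
    (λ (φ , p) → funToFin φ , λ x y e (q , r) →
      p x y e (trans (sym (FinP.finToFun-funToFin φ x)) q , trans (sym (FinP.finToFun-funToFin φ y)) r))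
    (FinP.any? {k ℕ.^ n} λ i → valid? c (finToFun i))

  open Orient {n}

  -- The conflict colours of `u` at the edges it owns. An arc of the list that is no edge of `G` has
  -- no conflict colour and is skipped.
  forbidden : ∀ {k} → LocalPartition G k → Fin n → List Arc → List (Fin k)
  forbidden c u []            = []
  forbidden c u ((s , t) ∷ L) with s ≟ u | T? (adj u t)
  ... | yes _ | yes e = c u t e ∷ forbidden c u L
  ... | yes _ | no _  = forbidden c u L
  ... | no _  | _     = forbidden c u L

  forbidden-length : ∀ {k} (c : LocalPartition G k) u L → length (forbidden c u L) ≤ outdegree u L
  forbidden-length c u []            = z≤n
  forbidden-length c u ((s , t) ∷ L) with s ≟ u | T? (adj u t)
  ... | yes _ | yes e = s≤s (forbidden-length c u L)
  ... | yes _ | no _  = m≤n⇒m≤1+n (forbidden-length c u L)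
  ... | no _  | _     = forbidden-length c u L

  forbidden-∈ : ∀ {k} (c : LocalPartition G k) {u t} L → (u , t) ∈ L → (e : Adj u t) → c u t e ∈ forbidden c u L
  forbidden-∈ c {u} {t} (_ ∷ L) (here refl) e with u ≟ u | T? (adj u t)
  ... | yes _ | yes e′ = here (cong (c u t) (T-irrelevant e e′))
  ... | yes _ | no ¬e  = contradiction e ¬e
  ... | no ≢  | _      = contradiction refl ≢
  forbidden-∈ c {u} ((s , r) ∷ L) (there p) e with s ≟ u | T? (adj u r)
  ... | yes _ | yes _ = there (forbidden-∈ c L p e)
  ... | yes _ | no _  = forbidden-∈ c L p e
  ... | no _  | _     = forbidden-∈ c L p e

  orientation⇒colouring : ∀ {k M} → (∀ {u v} → Adj u v → (u , v) ∈ M ⊎ (v , u) ∈ M) →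
    Orientation M (λ _ → k) → (c : LocalPartition G (suc k)) → ConflictColorable G c
  orientation⇒colouring {k} M-covers (L , L-covers , out) c = (λ u → proj₁ (pick u)) , proper
    where
    pick : ∀ u → ∃ λ i → i ∉ forbidden c u L
    pick u = fresh (forbidden c u L) (s≤s (≤-trans (forbidden-length c u L) (out u)))
    proper : Valid c (λ u → proj₁ (pick u))
    proper x y e (p , q) = [ [ x-owns , y-owns ]′ ∘ L-covers , [ y-owns , x-owns ]′ ∘ L-covers ]′ (M-covers e)
      where
      x-owns : (x , y) ∉ L
      x-owns xy∈L = proj₂ (pick x) (subst (_∈ forbidden c x L) (sym p) (forbidden-∈ c L xy∈L e))
      y-owns : (y , x) ∉ L
      y-owns yx∈L = proj₂ (pick y) (subst (_∈ forbidden c y L) (sym q) (forbidden-∈ c L yx∈L (reverse-edge e)))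

module Colouring {n : ℕ} {G : Graph n} (Δ : DartSystem G) where
  open Graph G
  open DartSystem Δ
  open Orient {n}

  arc : Fin N → Arc
  arc d = src d , tgt d

  -- Comparing the ends selects exactly one of the two darts of each edge.
  forward? : ∀ d → Dec (src d Fin.< tgt d)
  forward? d = src d FinP.<? tgt d

  size-tabulate : ∀ S {m} (g : Fin m → Fin N) → size S (map arc (filter forward? (tabulate g)))
                  ≡ sum (λ i → ⟦ forward? (g i) ⟧ * ⟦ T? (within S (arc (g i))) ⟧)
  size-tabulate S {zero}  g = refl
  size-tabulate S {suc m} g with does (forward? (g zero))
  ... | true  = cong₂ _+_ (sym (+-identityʳ _)) (size-tabulate S (g ∘ suc))
  ... | false = size-tabulate S (g ∘ suc)

  within-α : ∀ S d → within S (arc (α d)) ≡ within S (arc d)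
  within-α S d = trans (cong (λ e → S (tgt d) ∧ S (src e)) (α-involutive d)) (∧-comm (S (tgt d)) _)

  edges : List Arc
  edges = map arc (filter forward? (allFin N))

  twice-size : ∀ S → 2 * size S edges ≤ sum (λ d → ⟦ T? (within S (arc d)) ⟧)
  twice-size S = begin
    2 * size S edges                   ≡⟨ cong (2 *_) (size-tabulate S (λ d → d)) ⟩
    sum h + (sum h + 0)                ≡⟨ cong (sum h +_) (+-identityʳ _) ⟩
    sum h + sum h                      ≡⟨ cong (sum h +_) (sum-involution α-involutive h) ⟨
    sum h + sum (h ∘ α)                ≡⟨ ∑-distrib-+ h (h ∘ α) ⟨
    sum (λ d → h d + h (α d))          ≤⟨ sum-mono-≤ one-way ⟩
    sum (λ d → ⟦ T? (within S (arc d)) ⟧) ∎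
    where
    open ≤-Reasoning
    h : Fin N → ℕ
    h d = ⟦ forward? d ⟧ * ⟦ T? (within S (arc d)) ⟧
    one-way : ∀ d → h d + h (α d) ≤ ⟦ T? (within S (arc d)) ⟧
    one-way d = begin
      h d + h (α d)           ≡⟨ cong (λ b → h d + ⟦ forward? (α d) ⟧ * ⟦ T? b ⟧) (within-α S d) ⟩
      h d + ⟦ forward? (α d) ⟧ * ⟦ T? (within S (arc d)) ⟧ ≡⟨ *-distribʳ-+ _ ⟦ forward? d ⟧ _ ⟨
      (⟦ forward? d ⟧ + ⟦ forward? (α d) ⟧) * ⟦ T? (within S (arc d)) ⟧
        ≤⟨ *-monoˡ-≤ _ (⟦⟧-exclusive (forward? d) (forward? (α d)) λ f b →
            <-asym f (subst (λ e → tgt d Fin.< src e) (α-involutive d) b)) ⟩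
      1 * ⟦ T? (within S (arc d)) ⟧ ≡⟨ *-identityˡ _ ⟩
      ⟦ T? (within S (arc d)) ⟧ ∎

  edges-cover : ∀ {u v} → Adj u v → (u , v) ∈ edges ⊎ (v , u) ∈ edges
  edges-cover e with dart-of e
  ... | d , refl , refl with <-cmp (toℕ (src d)) (toℕ (tgt d))
  ...   | tri< f _ _ = inj₁ (∈-map⁺ arc (∈-filter⁺ forward? (∈-allFin d) f))
  ...   | tri≈ _ s≡t _ = contradiction (FinP.toℕ-injective s≡t) (dart-loopless d)
  ...   | tri> _ _ b = inj₂ (subst (λ w → (tgt d , w) ∈ edges) (cong src (α-involutive d))
                        (∈-map⁺ arc (∈-filter⁺ forward? (∈-allFin (α d))
                            (subst (λ e → tgt d Fin.< src e) (sym (α-involutive d)) b))))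

  -- The hypothesis counts darts, two for each edge; in terms of edges, every `S` spans at most `k`
  -- times its size. Capacity `k` at every vertex then leaves one of `k + 1` colours free.
  sparse⇒colorable : ∀ {k} → (∀ S → sum (λ d → ⟦ T? (within S (arc d)) ⟧) ≤ 2 * k * sum (λ u → ⟦ T? (S u) ⟧)) →
                     SingleConflictColorable G (suc k)
  sparse⇒colorable {k} sparse c = decidable-stable (conflict-colorable? {G = G} c)
    (¬¬-map (λ o → orientation⇒colouring {G = G} edges-cover o c)
        (orient edges (λ _ → k) loopless edges-sparse))
    where
    loopless : ∀ {u v} → (u , v) ∈ edges → u ≢ v
    loopless p with ∈-map⁻ arc p
    ... | d , _ , refl = dart-loopless d
    edges-sparse : Sparse edges (λ _ → k)
    edges-sparse S = *-cancelˡ-≤ 2 (begin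
      2 * size S edges                          ≤⟨ twice-size S ⟩
      sum (λ d → ⟦ T? (within S (arc d)) ⟧)     ≤⟨ sparse S ⟩
      2 * k * sum (λ u → ⟦ T? (S u) ⟧)          ≡⟨ *-assoc 2 k _ ⟩
      2 * (k * sum (λ u → ⟦ T? (S u) ⟧))        ≡⟨ cong (2 *_) (*-distribˡ-sum k (λ u → ⟦ T? (S u) ⟧)) ⟩
      2 * sum (λ u → k * ⟦ T? (S u) ⟧)          ≡⟨ cong (2 *_) (sum-cong-≗ λ u → *-comm k ⟦ T? (S u) ⟧) ⟩
      2 * total (λ _ → k) S                     ∎)
      where open ≤-Reasoning

-- Induced subgraphs

module Induced {n : ℕ} {G : Graph n} (Δ : DartSystem G) (S : Fin n → Bool) where
  open DartSystem Δ
  open OrbitColouring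
  open ClassLabelling

  In : Fin N → Set
  In d = T (S (src d) ∧ S (tgt d))

  in? : ∀ d → Dec (In d)
  in? d = T? _

  In-src : ∀ {d} → In d → T (S (src d))
  In-src = proj₁ ∘ Equivalence.to T-∧

  In-tgt : ∀ {d} → In d → T (S (tgt d))
  In-tgt = proj₂ ∘ Equivalence.to T-∧

  In-α : ∀ {d} → In d → In (α d)
  In-α {d} p = Equivalence.from T-∧ (In-tgt p , subst (λ e → T (S (src e))) (sym (α-involutive d)) (In-src p))

  In-α⁻ : ∀ {d} → In (α d) → In d
  In-α⁻ {d} p = subst In (α-involutive d) (In-α p)

  order darts outer : ℕ
  order = sum (λ u → ⟦ T? (S u) ⟧)
  darts = sum (λ d → ⟦ in? d ⟧)
  outer = sum (λ d → ⟦ ¬? (in? d) ⟧)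

  degree : Fin n → ℕ
  degree v = sum (λ d → ⟦ in? d ×-dec (src d ≟ v) ⟧)

  outside : List (Fin N)
  outside = filter (¬? ∘ in?) (allFin N)

  all-darts : darts + outer ≡ N
  all-darts = begin
    darts + outer                                  ≡⟨ ∑-distrib-+ (λ d → ⟦ in? d ⟧) (λ d → ⟦ ¬? (in? d) ⟧) ⟨
    sum (λ d → ⟦ in? d ⟧ + ⟦ ¬? (in? d) ⟧)       ≡⟨ sum-cong-≗ (λ d → ⟦⟧-¬ (in? d)) ⟩
    sum {N} (λ _ → 1)                              ≡⟨ sum-const N 1 ⟩
    N * 1                                          ≡⟨ *-identityʳ N ⟩
    N                                              ∎
    where open ≡-Reasoning

  module Faces (M : DetachedMap outside) where
    open DetachedMap M public

    face : Fin N → Fin N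
    face = σ ∘ α

    face-injective : Injective _≡_ _≡_ face
    face-injective = α-injective ∘ σ-injective

    out-fixed : ∀ {d} → ¬ In d → σ d ≡ d
    out-fixed {d} d∉ = σ-detached (∈-filter⁺ (¬? ∘ in?) (∈-allFin d) d∉)

    in-attached : ∀ {d e} → In d → In e → src d ≡ src e → EqClosure (Link σ) d e
    in-attached p q = σ-attached (attached p) (attached q)
      where
      attached : ∀ {d} → In d → d ∉ outside
      attached p d∈ = proj₂ (∈-filter⁻ (¬? ∘ in?) {xs = allFin N} d∈) p

    -- A detached dart is a fixed point of the injective `σ`, hence not the image of any other dart;
    -- no facial walk of the subgraph can run into it.
    In-face : ∀ {d} → In d → In (face d)
    In-face {d} p = decidable-stable (in? (face d)) λ out →
        out (subst In (sym (σ-injective (out-fixed out))) (In-α p))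

    In-iter : ∀ k {d} → In d → In (iter face k d)
    In-iter zero    p = p
    In-iter (suc k) p = In-face (In-iter k p)

    -- Otherwise `d` and `σ d` would be the only darts of the subgraph at their vertex. Through this
    -- lemma minimum degree 3 enters the study of facial walks.
    σ²-moves : ∀ {d} → In d → 3 ≤ degree (src d) → σ (σ d) ≢ d
    σ²-moves {d} p deg≥3 σσd≡d = <⇒≱ deg≥3 (count-pair (λ e → in? e ×-dec (src e ≟ src d)) d (σ d) λ e (q , s) →
      closed (λ e → e ≡ d ⊎ e ≡ σ d)
        (λ { refl (inj₁ refl) → inj₂ refl ; refl (inj₂ refl) → inj₁ σσd≡d })
        (λ { refl (inj₁ σe≡d) → inj₂ (σ-injective (trans σe≡d (sym σσd≡d))) ; refl (inj₂ σe≡σd) →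
            inj₁ (σ-injective σe≡σd) })
        (in-attached p q (sym s)) (inj₁ refl))

    -- One representative dart is chosen for each colour. Representatives in the subgraph have
    -- different sources in `S`, because its darts at a vertex form part of one orbit; the others
    -- are distinct detached darts.
    vertex-bound : V ≤ order + outer
    vertex-bound = begin
      V                                                      ≡⟨ *-identityʳ V ⟨
      V * 1                                                  ≡⟨ sum-const V 1 ⟨
      sum {V} (λ _ → 1)                                      ≡⟨ sum-cong-≗ (λ i → ⟦⟧-¬ (in? (rep i))) ⟨
      sum (λ i → ⟦ in? (rep i) ⟧ + ⟦ ¬? (in? (rep i)) ⟧)   ≡⟨ ∑-distrib-+ (λ i → ⟦ in? (rep i) ⟧) (λ i →
          ⟦ ¬? (in? (rep i)) ⟧) ⟩
      sum (λ i → ⟦ in? (rep i) ⟧) + sum (λ i → ⟦ ¬? (in? (rep i)) ⟧)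
        ≤⟨ +-mono-≤ (count-injection (in? ∘ rep) (T? ∘ S) (src ∘ rep) In-src (λ p q s →
            rep-injective (colour-orbit vertices (in-attached p q s))))
                    (count-injection (¬? ∘ in? ∘ rep) (¬? ∘ in?) rep id (λ _ _ e →
                        rep-injective (cong (colour vertices) e))) ⟩
      order + outer ∎
      where
      open ≤-Reasoning
      rep : Fin V → Fin N
      rep i = proj₁ (colour-onto vertices i)
      rep-injective : ∀ {i j} → colour vertices (rep i) ≡ colour vertices (rep j) → i ≡ j
      rep-injective {i} {j} e = trans (sym (proj₂ (colour-onto vertices i)))
          (trans e (proj₂ (colour-onto vertices j)))

    -- Both darts of a detached edge are fixed by `σ`, so they form a component by themselves.
    component-bound : outer ≤ 2 * C
    component-bound = count-fibres (¬? ∘ in?) (label components) α λ {d} {e} out _ e≡ →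
      closed (λ e → e ≡ d ⊎ e ≡ α d)
        (λ { (inj₁ refl) (inj₁ refl) → inj₁ (out-fixed out)
           ; (inj₁ refl) (inj₂ refl) → inj₂ (out-fixed (out ∘ In-α⁻))
           ; (inj₂ refl) (inj₁ refl) → inj₂ refl
           ; (inj₂ refl) (inj₂ refl) → inj₁ (α-involutive d) })
        (λ { (inj₁ refl) (inj₁ q) → inj₁ (σ-injective (trans q (sym (out-fixed out))))
           ; (inj₁ refl) (inj₂ q) → inj₂ (σ-injective (trans q (sym (out-fixed (out ∘ In-α⁻)))))
           ; (inj₂ refl) (inj₁ q) → inj₂ (trans (sym (α-involutive _)) (cong α q))
           ; (inj₂ refl) (inj₂ q) → inj₁ (α-injective q) })
        (label-classes components e≡) (inj₁ refl)

    -- Only an initial segment of the facial walk is weighed. Its darts are distinct, and the rest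
    -- of the face can only add weight.
    OnOrbit : (Fin N → ℕ) → ℕ → Fin N → Set
    OnOrbit W c d = ∃ λ m → Aperiodic face m d × c ≤ sum {m} (λ i → W (iter face (toℕ i) d))

    face-bound : ∀ W c → (∀ d → OnOrbit W c d) → F * c ≤ sum W
    face-bound W c heavy = begin
      F * c                                                    ≡⟨ sum-const F c ⟨
      sum {F} (λ _ → c)                                        ≤⟨ sum-mono-≤ class ⟩
      sum (λ i → sum (λ d → ⟦ colour faces d ≟ i ⟧ * W d))    ≡⟨ sum-fibres (colour faces) W ⟩
      sum W                                                    ∎
      where
      open ≤-Reasoning
      same-face : ∀ k d → colour faces (iter face k d) ≡ colour faces d
      same-face zero    d = refl
      same-face (suc k) d = trans (colour-step faces _) (same-face k d)
      class : ∀ i → c ≤ sum (λ d → ⟦ colour faces d ≟ i ⟧ * W d)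
      class i with colour-onto faces i
      ... | d , refl with heavy d
      ...   | m , aperiodic , c≤ = begin
        c                                           ≤⟨ c≤ ⟩
        sum {m} (λ j → W (walk j))                  ≡⟨ sum-cong-≗ (λ j →
            trans (sym (*-identityˡ _)) (cong (_* W (walk j))
            (sym (⟦⟧-yes (colour faces (walk j) ≟ colour faces d) (same-face (toℕ j) d))))) ⟩
        sum {m} (λ j → ⟦ colour faces (walk j) ≟ colour faces d ⟧ * W (walk j))
          ≤⟨ sum-injection (iter-distinct face-injective aperiodic) (λ e →
              ⟦ colour faces e ≟ colour faces d ⟧ * W e) ⟩
        sum (λ e → ⟦ colour faces e ≟ colour faces d ⟧ * W e) ∎
        where
        walk : Fin m → Fin N
        walk j = iter face (toℕ j) d

    -- A dart starts with `k`, sends `t d` across its edge and receives what the opposite dart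
    -- sends.
    charge : ℕ → (Fin N → ℕ) → Fin N → ℕ
    charge k t d = (k ∸ t d) + t (α d)

    module _ (k : ℕ) (t : Fin N → ℕ) (t≤k : ∀ d → t d ≤ k)
             (heavy : ∀ {d} → In d → OnOrbit (charge k t) (4 * k) d) where

      -- The 2-faces of the detached edges get the same charge 4k as every other face.
      total-charge : Fin N → ℕ
      total-charge d = ⟦ in? d ⟧ * charge k t d + ⟦ ¬? (in? d) ⟧ * (2 * k)

      charge-in : ∀ {d} → In d → total-charge d ≡ charge k t d
      charge-in {d} p rewrite dec-true (in? d) p = trans (+-identityʳ _) (+-identityʳ _)

      charge-out : ∀ {d} → ¬ In d → total-charge d ≡ 2 * k
      charge-out {d} ¬p rewrite dec-false (in? d) ¬p = +-identityʳ _

      all-heavy : ∀ d → OnOrbit total-charge (4 * k) d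
      all-heavy d with in? d
      ... | yes p with heavy p
      ...   | m , aperiodic , le = m , aperiodic , ≤-trans le
          (≤-reflexive (sum-cong-≗ {m} λ i → sym (charge-in (In-iter (toℕ i) p))))
      all-heavy d | no ¬p = 2 , aperiodic , ≤-reflexive
          (sym (trans (cong₂ (λ a b → a + (b + 0)) (charge-out ¬p) (charge-out out)) (four k)))
        where
        face≡α : face d ≡ α d
        face≡α = out-fixed (¬p ∘ In-α⁻)
        out : ¬ In (face d)
        out = ¬p ∘ In-α⁻ ∘ subst In face≡α
        aperiodic : Aperiodic face 2 d
        aperiodic zero    _ e = dart-loopless d (cong src (trans (sym e) face≡α))
        aperiodic (suc k) (s≤s (s≤s ()))
        four : ∀ k → 2 * k + (2 * k + 0) ≡ 4 * k
        four = solve-∀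

      -- Reindexing by `α` matches each unit received with the unit sent, so the transfers cancel.
      sum-charge : sum total-charge ≡ k * darts + 2 * k * outer
      sum-charge = begin
        sum total-charge
          ≡⟨ sum-cong-≗ regroup ⟩
        sum (λ d → kept d + given (α d))
          ≡⟨ ∑-distrib-+ kept (given ∘ α) ⟩
        sum kept + sum (given ∘ α)
          ≡⟨ cong (sum kept +_) (sum-involution α-involutive given) ⟩
        sum kept + sum given
          ≡⟨ ∑-distrib-+ kept given ⟨
        sum (λ d → kept d + given d)
          ≡⟨ sum-cong-≗ (λ d → trans (restore ⟦ in? d ⟧ (k ∸ t d) (t d) ⟦ ¬? (in? d) ⟧ k)
              (cong (λ z → z * ⟦ in? d ⟧ + 2 * k * ⟦ ¬? (in? d) ⟧) (m∸n+n≡m (t≤k d)))) ⟩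
        sum (λ d → k * ⟦ in? d ⟧ + 2 * k * ⟦ ¬? (in? d) ⟧)
          ≡⟨ ∑-distrib-+ (λ d → k * ⟦ in? d ⟧) (λ d → 2 * k * ⟦ ¬? (in? d) ⟧) ⟩
        sum (λ d → k * ⟦ in? d ⟧) + sum (λ d → 2 * k * ⟦ ¬? (in? d) ⟧)
          ≡⟨ cong₂ _+_ (*-distribˡ-sum k (λ d → ⟦ in? d ⟧)) (*-distribˡ-sum (2 * k) (λ d → ⟦ ¬? (in? d) ⟧)) ⟨
        k * darts + 2 * k * outer ∎
        where
        open ≡-Reasoning
        given kept : Fin N → ℕ
        given d = ⟦ in? d ⟧ * t d
        kept d = ⟦ in? d ⟧ * (k ∸ t d) + ⟦ ¬? (in? d) ⟧ * (2 * k)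
        regroup : ∀ d → total-charge d ≡ kept d + given (α d)
        regroup d = trans (shuffle ⟦ in? d ⟧ (k ∸ t d) (t (α d)) _)
            (cong (λ a → kept d + a * t (α d)) (⟦⟧-cong (in? d) (in? (α d)) In-α In-α⁻))
          where
          shuffle : ∀ a x y z → a * (x + y) + z ≡ a * x + z + a * y
          shuffle = solve-∀
        restore : ∀ a x y b k → a * x + b * (2 * k) + a * y ≡ (x + y) * a + 2 * k * b
        restore = solve-∀

      discharge : .{{_ : ℕ.NonZero k}} → darts ≤ 4 * order
      -- A detached dart accounts for 6 on either side: 2 through `N` and 4 through `C` on the left,
      -- 4 through `V` and 2 through `F` on the right.
      discharge = +-cancelʳ-≤ (darts + 6 * outer) _ _ (begin
        darts + (darts + 6 * outer)              ≡⟨ a₁ darts outer ⟩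
        2 * (darts + outer + 2 * outer)          ≤⟨ *-monoʳ-≤ 2
            (+-mono-≤ (≤-reflexive all-darts) (*-monoʳ-≤ 2 component-bound)) ⟩
        2 * (N + 2 * (2 * C))                    ≡⟨ cong (λ z → 2 * (N + z)) (sym (*-assoc 2 2 C)) ⟩
        2 * (N + 4 * C)                          ≤⟨ *-monoʳ-≤ 2 euler ⟩
        2 * (2 * (V + F))                        ≡⟨ a₂ V F ⟩
        4 * V + F * 4                            ≤⟨ +-mono-≤ (*-monoʳ-≤ 4 vertex-bound) few-faces ⟩
        4 * (order + outer) + (darts + 2 * outer) ≡⟨ a₃ order outer darts ⟩
        4 * order + (darts + 6 * outer)          ∎)
        where
        open ≤-Reasoning
        few-faces : F * 4 ≤ darts + 2 * outer
        few-faces = *-cancelʳ-≤ _ _ k (begin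
          F * 4 * k                      ≡⟨ *-assoc F 4 k ⟩
          F * (4 * k)                    ≤⟨ face-bound total-charge (4 * k) all-heavy ⟩
          sum total-charge               ≡⟨ sum-charge ⟩
          k * darts + 2 * k * outer      ≡⟨ a₄ k darts outer ⟩
          (darts + 2 * outer) * k        ∎)
          where
          a₄ : ∀ k d o → k * d + 2 * k * o ≡ (d + 2 * o) * k
          a₄ = solve-∀
        a₁ : ∀ d o → d + (d + 6 * o) ≡ 2 * (d + o + 2 * o)
        a₁ = solve-∀
        a₂ : ∀ V F → 2 * (2 * (V + F)) ≡ 4 * V + F * 4
        a₂ = solve-∀
        a₃ : ∀ s o d → 4 * (s + o) + (d + 2 * o) ≡ 4 * s + (d + 6 * o)
        a₃ = solve-∀

-- Reduction to minimum degree 3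

module _ {n : ℕ} {G : Graph n} (Δ : DartSystem G) where
  open DartSystem Δ
  open Induced Δ using (order; darts; degree)

  module _ (S : Fin n → Bool) {v : Fin n} (Sv : T (S v)) where
    open Induced Δ S using (In; in?; In-α; In-src; In-tgt)

    delete : Fin n → Bool
    delete u = S u ∧ not (does (v ≟ u))

    delete-other : ∀ {u} → v ≢ u → T (S u) → T (delete u)
    delete-other {u} v≢u Su rewrite dec-false (v ≟ u) v≢u = Equivalence.from T-∧ (Su , tt)

    order-delete : order S ≡ suc (order delete)
    order-delete = begin
      order S                                                           ≡⟨ sum-cong-≗ vertex ⟩
      sum (λ u → ⟦ v ≟ u ⟧ * 1 + ⟦ T? (delete u) ⟧)                    ≡⟨ ∑-distrib-+ (λ u →
          ⟦ v ≟ u ⟧ * 1) (λ u → ⟦ T? (delete u) ⟧) ⟩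
      sum (λ u → ⟦ v ≟ u ⟧ * 1) + order delete                          ≡⟨ cong (_+ order delete)
          (sum-δ v (λ _ → 1)) ⟩
      suc (order delete)                                                ∎
      where
      open ≡-Reasoning
      vertex : ∀ u → ⟦ T? (S u) ⟧ ≡ ⟦ v ≟ u ⟧ * 1 + ⟦ T? (delete u) ⟧
      vertex u with v ≟ u
      ... | yes refl rewrite Equivalence.to T-≡ Sv = refl
      ... | no _ with S u
      ...   | true  = refl
      ...   | false = refl

    -- A dart lost by the deletion leaves `v` or is the reversal of a dart leaving `v`.
    darts-delete : darts S ≤ darts delete + 2 * degree S v
    darts-delete = begin
      darts S                                           ≤⟨ sum-mono-≤ dart-bound ⟩
      sum (λ d → kept d + (at d + at (α d)))             ≡⟨ ∑-distrib-+ kept (λ d → at d + at (α d)) ⟩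
      darts delete + sum (λ d → at d + at (α d))         ≡⟨ cong (darts delete +_) (∑-distrib-+ at (at ∘ α)) ⟩
      darts delete + (degree S v + sum (at ∘ α))         ≡⟨ cong (λ z →
          darts delete + (degree S v + z)) (trans (sum-involution α-involutive at) (sym (+-identityʳ _))) ⟩
      darts delete + 2 * degree S v                      ∎
      where
      open ≤-Reasoning
      kept at : Fin N → ℕ
      kept d = ⟦ Induced.in? Δ delete d ⟧
      at d = ⟦ in? d ×-dec (src d ≟ v) ⟧
      dart-bound : ∀ d → ⟦ in? d ⟧ ≤ kept d + (at d + at (α d))
      dart-bound d = cases (src d ≟ v) (tgt d ≟ v)
        where
        cases : Dec (src d ≡ v) → Dec (tgt d ≡ v) → ⟦ in? d ⟧ ≤ kept d + (at d + at (α d))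
        cases (yes s) _ = ≤-trans (⟦⟧-mono (in? d) (in? d ×-dec (src d ≟ v)) (_, s))
            (≤-trans (m≤m+n (at d) _) (m≤n+m _ (kept d)))
        cases (no _) (yes t) = ≤-trans (⟦⟧-mono (in? d) (in? (α d) ×-dec (tgt d ≟ v)) (λ p → In-α p , t))
            (≤-trans (m≤n+m (at (α d)) (at d)) (m≤n+m _ (kept d)))
        cases (no s) (no t) = ≤-trans (⟦⟧-mono (in? d) (Induced.in? Δ delete d) λ p → Equivalence.from T-∧
          (delete-other (s ∘ sym) (In-src p) , delete-other (t ∘ sym) (In-tgt p))) (m≤m+n (kept d) _)

  -- Deleting a vertex of degree at most 2 removes at most 4 darts.
  min-degree-3-suffices : (∀ S → (∀ v → T (S v) → 3 ≤ degree S v) → darts S ≤ 4 * order S) →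
                          ∀ S → darts S ≤ 4 * order S
  min-degree-3-suffices dense S = go S (<-wellFounded (order S))
    where
    go : ∀ S → Acc _<_ (order S) → darts S ≤ 4 * order S
    go S (acc rec) with FinP.any? (λ v → T? (S v) ×-dec (degree S v ℕ.<? 3))
    ... | no ∄ = dense S λ v Sv → ≮⇒≥ λ small → ∄ (v , Sv , small)
    ... | yes (v , Sv , s≤s small) = begin
      darts S                                  ≤⟨ darts-delete S Sv ⟩
      darts S′ + 2 * degree S v                ≤⟨ +-mono-≤
          (go S′ (rec (≤-reflexive (sym (order-delete S Sv))))) (*-monoʳ-≤ 2 small) ⟩
      4 * order S′ + 4                         ≡⟨ trans (+-comm _ 4) (sym (*-suc 4 (order S′))) ⟩
      4 * suc (order S′)                       ≡⟨ cong (4 *_) (order-delete S Sv) ⟨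
      4 * order S                              ∎
      where
      open ≤-Reasoning
      S′ = delete S Sv

-- Facial walks and short cycles

module _ {n : ℕ} {G : Graph n} where
  open Cycle

  ≈-sym : ∀ {k l} {c : Cycle G k} {d : Cycle G l} → c ≈ d → d ≈ c
  ≈-sym c≈d u v = mk⇔ (Equivalence.from (c≈d u v)) (Equivalence.to (c≈d u v))

  edge⇒vertex : ∀ {k} (c : Cycle G k) {u v} → HasEdge c u v → HasVertex c u
  edge⇒vertex c (i , inj₁ (e , _)) = i , e
  edge⇒vertex c (i , inj₂ (_ , e)) = next i , e

  ≈-vertex : ∀ {k l} {c : Cycle G k} {d : Cycle G l} → c ≈ d → ∀ i → HasVertex d (vertex c i)
  ≈-vertex {c = c} {d} c≈d i = edge⇒vertex d (Equivalence.to (c≈d _ _) (i , inj₁ (refl , refl)))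

  -- Cycles with the same edges have the same vertices, and the vertices of the longer cycle do not
  -- fit on the shorter one. This supplies the inequality that `Adjacent` demands between cycles of
  -- different lengths.
  longer-≉ : ∀ {k l} {c : Cycle G k} {d : Cycle G l} → k < l → ¬ d ≈ c
  longer-≉ {c = c} {d} k<l d≈c with FinP.pigeonhole k<l (λ i → proj₁ (≈-vertex {c = d} {d = c} d≈c i))
  ... | i , j , i<j , e = <⇒≢ i<j (cong toℕ (distinct d
    (trans (sym (proj₂ (≈-vertex {c = d} {d = c} d≈c i)))
        (trans (cong (vertex c) e) (proj₂ (≈-vertex {c = d} {d = c} d≈c j))))))

  adjacent-longer : ∀ {k l} {c : Cycle G k} {d : Cycle G l} {u v} → k < l → HasEdge c u v → HasEdge d u v →
      Adjacent c d
  adjacent-longer {c = c} {d} k<l e e′ = longer-≉ {c = c} {d = d} k<l ∘ ≈-sym {c = c} {d = d} , _ , _ , e , e′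

  adjacent-shorter : ∀ {k l} {c : Cycle G k} {d : Cycle G l} {u v} → k < l → HasEdge c u v → HasEdge d u v →
      Adjacent d c
  adjacent-shorter {c = c} {d} k<l e e′ = longer-≉ {c = c} {d = d} k<l , _ , _ , e′ , e

  neighbour : ∀ {k} (c : Cycle G k) {j w} → HasEdge c (vertex c j) w →
              w ≡ vertex c (next j) ⊎ ∃ λ i → next i ≡ j × w ≡ vertex c i
  neighbour c (i , inj₁ (p , q)) = inj₁ (trans (sym q) (cong (vertex c ∘ next) (distinct c p)))
  neighbour c (i , inj₂ (p , q)) = inj₂ (i , distinct c q , sym p)

  cycle : ∀ (vs : List (Fin n)) → 3 ≤ length vs → Unique vs →
          (∀ i → Graph.Adj G (lookup vs i) (lookup vs (next i))) → Cycle G (length vs)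
  cycle vs 3≤ unique joined = record { 3≤length = 3≤ ; vertex = lookup vs ; distinct = lookup-injective
      unique ; joined = joined }

module Walks {n : ℕ} {G : Graph n} (Δ : DartSystem G) (S : Fin n → Bool)
             (deg≥3 : ∀ v → T (S v) → 3 ≤ Induced.degree Δ S v)
             (M : DartSystem.DetachedMap Δ (Induced.outside Δ S)) where
  open Graph G
  open DartSystem Δ
  open Induced Δ S
  open Faces M

  -- Position after `k` steps of the facial walk that starts along `d`.
  p : ℕ → Fin N → Fin n
  p k d = src (iter face k d)

  p-suc : ∀ k d → p (suc k) d ≡ tgt (iter face k d)
  p-suc k d = σ-source (α (iter face k d))

  p-adjacent : ∀ k d → Adj (p k d) (p (suc k) d)
  p-adjacent k d = subst (Adj (p k d)) (sym (p-suc k d)) (dart-adjacent (iter face k d))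

  p₀α : ∀ d → p 0 (α d) ≡ p 1 d
  p₀α d = sym (p-suc 0 d)

  p₁α : ∀ d → p 1 (α d) ≡ p 0 d
  p₁α d = trans (p-suc 0 (α d)) (cong src (α-involutive d))

  dart-≡ : ∀ {d e} → p 0 d ≡ p 0 e → p 1 d ≡ p 1 e → d ≡ e
  dart-≡ {d} {e} s t = dart-unique s (trans (sym (p-suc 0 d)) (trans t (p-suc 0 e)))

  σ²-moves-at : ∀ {d} → In d → σ (σ d) ≢ d
  σ²-moves-at q = σ²-moves q (deg≥3 _ (In-src q))

  p₀≢p₁ : ∀ d → p 0 d ≢ p 1 d
  p₀≢p₁ d e = dart-loopless d (trans e (p-suc 0 d))

  -- In a simple graph a walk returns after two steps only along the edge it came by. Then `α d` is
  -- fixed by `σ`, and the vertex `p 1 d` has degree 1.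
  p₀≢p₂ : ∀ {d} → In d → p 0 d ≢ p 2 d
  p₀≢p₂ {d} q e = σ²-moves-at (In-α q) (trans (cong σ σα≡α) σα≡α)
    where
    σα≡α : face d ≡ α d
    σα≡α = dart-≡ (sym (p₀α d)) (trans (sym e) (sym (p₁α d)))

  -- Literally, the length of the face divides `k`. Lengths 1 and 2 do not occur in the subgraph, so
  -- there `k` = 3, 4 or 5 is the exact length.
  Closes : ℕ → Fin N → Set
  Closes k d = iter face k d ≡ d

  closes? : ∀ k d → Dec (Closes k d)
  closes? k d = iter face k d ≟ d

  iter-comm : ∀ k d → iter face k (face d) ≡ face (iter face k d)
  iter-comm zero    d = refl
  iter-comm (suc k) d = cong face (iter-comm k d)

  closes-face : ∀ k {d} → Closes k d → Closes k (face d)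
  closes-face k {d} c = trans (iter-comm k d) (cong face c)

  ¬closes-1 : ∀ d → ¬ Closes 1 d
  ¬closes-1 d c = p₀≢p₁ d (cong src (sym c))

  ¬closes-2 : ∀ {d} → In d → ¬ Closes 2 d
  ¬closes-2 q c = p₀≢p₂ q (cong src (sym c))

  -- On a closed walk of length at most 5, any two positions are at most two steps apart in one of
  -- the directions. So `p₀≢p₁` and `p₀≢p₂` make the boundary a cycle; the same argument serves
  -- lengths 4 and 5 below.
  triangle : ∀ {d} → In d → Closes 3 d → Triangle G
  triangle {d} q c = cycle (p 0 d ∷ p 1 d ∷ p 2 d ∷ []) ≤-refl
    ((p₀≢p₁ d ∷ p₀≢p₂ q ∷ []) ∷ (p₀≢p₁ (face d) ∷ []) ∷ [] ∷ [])
    λ { 0F → p-adjacent 0 d ; 1F → p-adjacent 1 d ; 2F → subst (Adj (p 2 d)) (cong src c) (p-adjacent 2 d) }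

  4-cycle : ∀ {d} → In d → Closes 4 d → Cycle G 4
  4-cycle {d} q c = cycle (p 0 d ∷ p 1 d ∷ p 2 d ∷ p 3 d ∷ []) (s≤s (s≤s (s≤s z≤n)))
    ((p₀≢p₁ d ∷ p₀≢p₂ q ∷ (λ e → p₀≢p₁ _ (trans (sym e) (cong src (sym c)))) ∷ []) ∷
     (p₀≢p₁ (face d) ∷ p₀≢p₂ (In-face q) ∷ []) ∷ (p₀≢p₁ _ ∷ []) ∷ [] ∷ [])
    λ { 0F → p-adjacent 0 d ; 1F → p-adjacent 1 d ; 2F → p-adjacent 2 d ; 3F →
        subst (Adj (p 3 d)) (cong src c) (p-adjacent 3 d) }

  5-cycle : ∀ {d} → In d → Closes 5 d → Cycle G 5
  5-cycle {d} q c = cycle (p 0 d ∷ p 1 d ∷ p 2 d ∷ p 3 d ∷ p 4 d ∷ []) (s≤s (s≤s (s≤s z≤n)))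
    ((p₀≢p₁ d ∷ p₀≢p₂ q ∷ (λ e → p₀≢p₂ (In-iter 3 q) (trans (sym e) (cong src (sym c)))) ∷
        (λ e → p₀≢p₁ _ (trans (sym e) (cong src (sym c)))) ∷ []) ∷
     (p₀≢p₁ _ ∷ p₀≢p₂ (In-iter 1 q) ∷ (λ e →
         p₀≢p₂ (In-iter 4 q) (trans (sym e) (cong src (cong face (sym c))))) ∷ []) ∷
     (p₀≢p₁ _ ∷ p₀≢p₂ (In-iter 2 q) ∷ []) ∷ (p₀≢p₁ _ ∷ []) ∷ [] ∷ [])
    λ { 0F → p-adjacent 0 d ; 1F → p-adjacent 1 d ; 2F → p-adjacent 2 d ; 3F → p-adjacent 3 d
      ; 4F → subst (Adj (p 4 d)) (cong src c) (p-adjacent 4 d) }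

  open Cycle using (HasVertex; HasEdge)

  Across : Fin N → Set
  Across d = Closes 3 (α d)

  triangle-across : ∀ {d} → In d → Across d → Triangle G
  triangle-across q c = triangle (In-α q) c

  -- If the triangle on the other side of d contained the next vertex p 2 d of the facial
  -- walk, then the vertex p 1 d between the two would have degree 2.
  turns-away : ∀ {d} (q : In d) (c : Across d) → ¬ HasVertex (triangle-across q c) (p 2 d)
  turns-away {d} q c (0F , e) = p₀≢p₁ (face d) (trans (sym (p₀α d)) e)
  turns-away {d} q c (1F , e) = p₀≢p₂ q (trans (sym (p₁α d)) e)
  turns-away {d} q c (2F , e) = σ²-moves-at (In-α q) (trans (cong σ (sym σα≡)) c)
    where
    last≡ : iter face 2 (α d) ≡ α (face d)
    last≡ = dart-≡ (trans e (sym (p₀α (face d)))) (trans (trans (cong src c) (p₀α d)) (sym (p₁α (face d))))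
    σα≡ : α (iter face 2 (α d)) ≡ face d
    σα≡ = trans (cong α last≡) (α-involutive (face d))

  has-p₀ : ∀ {d} (q : In d) (c : Across d) → HasVertex (triangle-across q c) (p 0 d)
  has-p₀ q c = 1F , p₁α _

  has-p₁ : ∀ {d} (q : In d) (c : Across d) → HasVertex (triangle-across q c) (p 1 d)
  has-p₁ q c = 0F , p₀α _

  across-edge : ∀ {d} (q : In d) (c : Across d) → HasEdge (triangle-across q c) (p 0 d) (p 1 d)
  across-edge q c = 0F , inj₂ (p₀α _ , p₁α _)

  ≈-hasVertex : ∀ {t t′ : Triangle G} → t ≈ t′ → ∀ {v} → HasVertex t v → HasVertex t′ v
  ≈-hasVertex {t} {t′} t≈t′ (i , refl) = ≈-vertex {c = t} {d = t′} t≈t′ i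

  -- The other triangle contains `p 2 d`, which the triangle across `d` avoids by `turns-away`. The
  -- next two lemmas hold for the same reason.
  different-from-next : ∀ {d} (q : In d) (c : Across d) (c′ : Across (face d)) →
                        ¬ triangle-across q c ≈ triangle-across (In-face q) c′
  different-from-next {d} q c c′ t≈t′ = turns-away q c
      (≈-hasVertex {triangle-across (In-face q) c′} {triangle-across q c}
    (≈-sym {c = triangle-across q c} {d = triangle-across (In-face q) c′} t≈t′) (has-p₁ (In-face q) c′))

  different-from-second : ∀ {d} (q : In d) (c : Across d) (c′ : Across (face (face d))) →
                        ¬ triangle-across q c ≈ triangle-across (In-face (In-face q)) c′
  different-from-second {d} q c c′ t≈t′ = turns-away q c
      (≈-hasVertex {triangle-across (In-face (In-face q)) c′} {triangle-across q c}
    (≈-sym {c = triangle-across q c} {d = triangle-across (In-face (In-face q)) c′} t≈t′)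
        (has-p₀ (In-face (In-face q)) c′))

  different-from-own : ∀ {d} (q : In d) (own : Closes 3 d) (c : Across d) →
      ¬ triangle q own ≈ triangle-across q c
  different-from-own {d} q own c t≈t′ = turns-away q c
      (≈-hasVertex {triangle q own} {triangle-across q c} t≈t′ (2F , refl))

  -- Equal cycles would have the same two edges at the common vertex `v`, which is `p 1 d`. Neither
  -- neighbour of `v` on `Q′` is the neighbour `p 0 d` on `Q`: for one of them this is `p₀≢p₂`, for
  -- the other it would give `v` degree 2. So both would have to be the single remaining neighbour
  -- on `Q`, although they differ.
  4-cycles-across-differ : ∀ {d} (q : In d) → Closes 3 d → (c : Closes 4 (α d)) (c′ : Closes 4 (α (face d))) →
    ¬ 4-cycle (In-α q) c ≈ 4-cycle (In-α (In-face q)) c′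
  4-cycles-across-differ {d} q own c c′ Q≈Q′ = two-neighbours
    (neighbour Q {0F} (Equivalence.from (Q≈Q′ v _)
        (subst (λ x → HasEdge Q′ x (p 0 (α (face d)))) (sym v≡) (0F , inj₂ (refl , refl)))))
    (neighbour Q {0F} (Equivalence.from (Q≈Q′ v _)
        (subst (λ x → HasEdge Q′ x (p 2 (α (face d)))) (sym v≡) (1F , inj₁ (refl , refl)))))
    where
    Q  = 4-cycle (In-α q) c
    Q′ = 4-cycle (In-α (In-face q)) c′
    v  = p 0 (α d)
    v≡ : v ≡ p 1 (α (face d))
    v≡ = trans (p₀α d) (sym (p₁α (face d)))
    w≢u : p 0 (α (face d)) ≢ p 1 (α d)
    w≢u e = p₀≢p₂ q (trans (sym (p₁α d)) (trans (sym e) (p₀α (face d))))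
    a≢u : p 2 (α (face d)) ≢ p 1 (α d)
    a≢u e = σ²-moves-at (In-α q) (trans (cong σ (sym (α-involutive (face d)))) (dart-≡ (sym v≡) e))
    a≢w : p 2 (α (face d)) ≢ p 0 (α (face d))
    a≢w = p₀≢p₂ (In-α (In-face q)) ∘ sym
    Neighbour : Fin n → Set
    Neighbour x = x ≡ p 1 (α d) ⊎ ∃ λ i → next i ≡ 0F × x ≡ Cycle.vertex Q i
    two-neighbours : Neighbour (p 0 (α (face d))) → Neighbour (p 2 (α (face d))) → ⊥
    two-neighbours (inj₁ e) _ = w≢u e
    two-neighbours (inj₂ _) (inj₁ e) = a≢u e
    two-neighbours (inj₂ (3F , _ , e)) (inj₂ (3F , _ , e′)) = a≢w (trans e′ (sym e))

-- Discharging

module Discharging {n : ℕ} {G : Graph n} (Δ : DartSystem G) (S : Fin n → Bool)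
             (deg≥3 : ∀ v → T (S v) → 3 ≤ Induced.degree Δ S v)
             (M : DartSystem.DetachedMap Δ (Induced.outside Δ S)) where
  open DartSystem Δ
  open Induced Δ S
  open Faces M
  open Walks Δ S deg≥3 M

  Gives : Fin N → Set
  Gives d = Across d × ¬ Closes 3 d × ¬ Closes 4 d

  gives? : ∀ d → Dec (Gives d)
  gives? d = closes? 3 (α d) ×-dec ¬? (closes? 3 d) ×-dec ¬? (closes? 4 d)

  -- Every dart of a face of length at least 5 sends a unit of charge to the triangle across it.
  gift : Fin N → ℕ
  gift d = ⟦ gives? d ⟧

  gifts : ℕ → Fin N → ℕ
  gifts m d = sum {m} (λ i → gift (iter face (toℕ i) d))

  received : Fin N → ℕ
  received d = sum {3} (λ i → gift (α (iter face (toℕ i) d)))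

  no-gifts : ∀ m {d} → (∀ k → ¬ Gives (iter face k d)) → gifts m d ≡ 0
  no-gifts m ¬gives = sum-zero {m} λ i → ⟦⟧-no (gives? _) (¬gives (toℕ i))

  closes-iter : ∀ j k {d} → Closes k d → Closes k (iter face j d)
  closes-iter zero    k c = c
  closes-iter (suc j) k c = closes-face k (closes-iter j k c)

  -- With `k` per dart and a target of `4 * k`, a triangle must receive `k`, a 4-face is balanced
  -- and gives nothing, and a pentagon may give `k`. On a longer face six consecutive darts already
  -- suffice, with `2 * k` to give away.
  discharge-short-faces : ∀ k → 1 ≤ k → (∀ {d} → In d → Closes 3 d → k ≤ received d) →
          (∀ {d} → In d → Closes 5 d → gifts 5 d ≤ k) →
          (∀ {d} → In d → gifts 6 d ≤ 2 * k) →
          darts ≤ 4 * order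
  discharge-short-faces k 1≤k triangles pentagons long = discharge k gift (λ d →
      ≤-trans (⟦⟧≤1 (gives? d)) 1≤k) heavy {{ℕ.>-nonZero 1≤k}}
    where
    open ≤-Reasoning
    walk-charge : ∀ m d → m * k + sum {m} (λ i → gift (α (iter face (toℕ i) d))) ≡
                  sum {m} (λ i → charge k gift (iter face (toℕ i) d)) + gifts m d
    walk-charge m d = begin-equality
      m * k + sum {m} across                                   ≡⟨ cong (_+ sum {m} across) (sum-const m k) ⟨
      sum {m} (λ _ → k) + sum {m} across                       ≡⟨ ∑-distrib-+ {m} (λ _ → k) across ⟨
      sum {m} (λ i → k + across i)                             ≡⟨ sum-cong-≗ {m} (λ i →
          trans (cong (_+ across i) (sym (m∸n+n≡m (≤-trans (⟦⟧≤1 (gives? (iter face (toℕ i) d))) 1≤k))))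
          (shuffle (k ∸ own i) (own i) (across i))) ⟩
      sum {m} (λ i → charge k gift (iter face (toℕ i) d) + own i) ≡⟨ ∑-distrib-+ {m} (λ i →
          charge k gift (iter face (toℕ i) d)) own ⟩
      sum {m} (λ i → charge k gift (iter face (toℕ i) d)) + gifts m d ∎
      where
      own across : Fin m → ℕ
      own i = gift (iter face (toℕ i) d)
      across i = gift (α (iter face (toℕ i) d))
      shuffle : ∀ a b c → a + b + c ≡ a + c + b
      shuffle = solve-∀
    on-orbit : ∀ m {d} → Aperiodic face m d →
        4 * k + gifts m d ≤ m * k + sum {m} (λ i → gift (α (iter face (toℕ i) d))) →
               OnOrbit (charge k gift) (4 * k) d
    on-orbit m {d} aperiodic le = m , aperiodic , +-cancelʳ-≤ (gifts m d) _ _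
        (≤-trans le (≤-reflexive (walk-charge m d)))
    heavy : ∀ {d} → In d → OnOrbit (charge k gift) (4 * k) d
    heavy {d} q with closes? 3 d
    ... | yes c₃ = on-orbit 3
      (λ { 0 _ → ¬closes-1 d ; 1 _ → ¬closes-2 q ; (suc (suc _)) (s≤s (s≤s (s≤s ()))) })
      (begin
        4 * k + gifts 3 d     ≡⟨ trans (cong (4 * k +_) (no-gifts 3 λ j g →
            proj₁ (proj₂ g) (closes-iter j 3 c₃))) (trans (+-identityʳ _) (+-comm k (3 * k))) ⟩
        3 * k + k             ≤⟨ +-monoʳ-≤ (3 * k) (triangles q c₃) ⟩
        3 * k + received d    ∎)
    ... | no ¬c₃ with closes? 4 d
    ...   | yes c₄ = on-orbit 4
      (λ { 0 _ → ¬closes-1 d ; 1 _ → ¬closes-2 q ; 2 _ → ¬c₃ ; (suc (suc (suc _))) (s≤s (s≤s (s≤s (s≤s ())))) })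
      (+-monoʳ-≤ (4 * k) (≤-trans (≤-reflexive (no-gifts 4 λ j g → proj₂ (proj₂ g) (closes-iter j 4 c₄))) z≤n))
    ...   | no ¬c₄ with closes? 5 d
    ...     | yes c₅ = on-orbit 5
      (λ { 0 _ → ¬closes-1 d ; 1 _ → ¬closes-2 q ; 2 _ → ¬c₃ ; 3 _ →
          ¬c₄ ; (suc (suc (suc (suc _)))) (s≤s (s≤s (s≤s (s≤s (s≤s ()))))) })
      (begin
        4 * k + gifts 5 d     ≤⟨ +-monoʳ-≤ (4 * k) (pentagons q c₅) ⟩
        4 * k + k             ≡⟨ +-comm (4 * k) k ⟩
        5 * k                 ≤⟨ m≤m+n (5 * k) _ ⟩
        _                     ∎)
    ...     | no ¬c₅ = on-orbit 6
      (λ { 0 _ → ¬closes-1 d ; 1 _ → ¬closes-2 q ; 2 _ → ¬c₃ ; 3 _ → ¬c₄ ; 4 _ →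
          ¬c₅ ; (suc (suc (suc (suc (suc _))))) (s≤s (s≤s (s≤s (s≤s (s≤s (s≤s ())))))) })
      (begin
        4 * k + gifts 6 d     ≤⟨ +-monoʳ-≤ (4 * k) (long q) ⟩
        4 * k + 2 * k         ≡⟨ *-distribʳ-+ k 4 2 ⟨
        6 * k                 ≤⟨ m≤m+n (6 * k) _ ⟩
        _                     ∎)

  gives-across : ∀ {d} → Across (α d) → ¬ Across d → ¬ Closes 4 (α d) → 1 ≤ gift (α d)
  gives-across c ¬c₃ ¬c₄ = ≤-reflexive (sym (⟦⟧-yes (gives? (α _)) (c , ¬c₃ , ¬c₄)))

  across-α : ∀ {d} → Closes 3 d → Across (α d)
  across-α {d} c = subst (Closes 3) (sym (α-involutive d)) c

  -- Condition (i): pairwise disjoint triangles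

  module IntersectionFree (isolated : NoIntersectingTriangles G)
      (one-4-cycle : TrianglesAdjacentToAtMostOne4Cycle G) where

    private
      shared : ∀ {t t′ : Triangle G} {v} → Cycle.HasVertex t v → Cycle.HasVertex t′ v → ¬ ¬ t ≈ t′
      shared {t} {t′} h h′ t≉t′ = isolated t t′ (t≉t′ , _ , h , h′)

    lone-triangle : ∀ {d} → In d → Closes 3 d → ¬ Across d
    lone-triangle q own c = shared {triangle q own} {triangle-across q c} (0F , refl) (has-p₀ q c)
        (different-from-own q own c)

    -- The triangles across two consecutive darts would be different and meet in `p 1 d`.
    not-consecutive : ∀ {d} → In d → gift d + gift (face d) ≤ 1
    not-consecutive {d} q = ⟦⟧-exclusive (gives? d) (gives? (face d)) λ (c , _) (c′ , _) →
      shared {triangle-across q c} {triangle-across (In-face q) c′} (has-p₁ q c) (has-p₀ (In-face q) c′)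
          (different-from-next q c c′)

    -- If 4-faces lay across both sides, they would be two different 4-cycles adjacent to the
    -- triangle. A triangle cannot lie across either side, so one of the two faces has length at
    -- least 5 and gives.
    one-receives : ∀ {d} → In d → Closes 3 d → 1 ≤ gift (α d) + gift (α (face d))
    one-receives {d} q own = cases (closes? 4 (α d)) (closes? 4 (α (face d)))
      where
      t = triangle q own
      cases : Dec (Closes 4 (α d)) → Dec (Closes 4 (α (face d))) → 1 ≤ gift (α d) + gift (α (face d))
      cases (no ¬c₄) _ = ≤-trans (gives-across (across-α own) (lone-triangle q own) ¬c₄) (m≤m+n _ _)
      cases (yes _) (no ¬c₄) = ≤-trans (gives-across (across-α own′) (lone-triangle (In-face q) own′) ¬c₄)
          (m≤n+m _ (gift (α d)))
        where own′ = closes-face 3 own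
      cases (yes c) (yes c′) = ⊥-elim (same-pair (one-4-cycle t both adjacent))
        where
        both : Fin 2 → Cycle G 4
        both 0F = 4-cycle (In-α q) c
        both 1F = 4-cycle (In-α (In-face q)) c′
        adjacent : ∀ i → Adjacent t (both i)
        adjacent 0F = adjacent-longer {c = t} {d = both 0F} ≤-refl (0F , inj₁ (refl , refl))
            (0F , inj₂ (p₀α d , p₁α d))
        adjacent 1F = adjacent-longer {c = t} {d = both 1F} ≤-refl (1F , inj₁ (refl , refl))
            (0F , inj₂ (p₀α (face d) , p₁α (face d)))
        same-pair : ¬ ∃₂ λ i j → i ≢ j × both i ≈ both j
        same-pair (0F , 0F , ≢ , _) = ≢ refl
        same-pair (1F , 1F , ≢ , _) = ≢ refl
        same-pair (0F , 1F , _ , e) = 4-cycles-across-differ q own c c′ e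
        same-pair (1F , 0F , _ , e) = 4-cycles-across-differ q own c c′ (≈-sym {c = both 1F} {d = both 0F} e)

    sparse : darts ≤ 4 * order
    sparse = discharge-short-faces 2 (s≤s z≤n)
      (λ {d} q own → at-least-two (gift (α d)) (gift (α (face d))) (gift (α (face (face d))))
          (one-receives q own) (one-receives (In-face q) (closes-face 3 own))
         (subst (λ e → 1 ≤ gift (α (iter face 2 d)) + gift (α e)) own
             (one-receives (In-iter 2 q) (closes-iter 2 3 own))))
      (λ {d} q c₅ → at-most-two (gift (iter face 0 d)) (gift (iter face 1 d)) (gift (iter face 2 d))
          (gift (iter face 3 d)) (gift (iter face 4 d))
         (not-consecutive q) (not-consecutive (In-iter 1 q)) (not-consecutive (In-iter 2 q))
             (not-consecutive (In-iter 3 q))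
         (subst (λ e → gift (iter face 4 d) + gift e ≤ 1) c₅ (not-consecutive (In-iter 4 q))))
      (λ {d} q → ≤-trans (≤-reflexive (pairs (gift (iter face 0 d)) (gift (iter face 1 d))
          (gift (iter face 2 d)) (gift (iter face 3 d)) (gift (iter face 4 d)) (gift (iter face 5 d))))
          (≤-trans (+-mono-≤ (not-consecutive q)
          (+-mono-≤ (not-consecutive (In-iter 2 q)) (not-consecutive (In-iter 4 q)))) (n≤1+n 3)))
      where
      pairs : ∀ a b c d e f → a + (b + (c + (d + (e + (f + 0))))) ≡ (a + b) + ((c + d) + (e + f))
      pairs = solve-∀
      -- Each pair of sides receives a unit, so twice the sum is at least 3, and integrality raises
      -- the sum to 2. Dually, in `at-most-two` twice the sum is at most 5.
      at-least-two : ∀ a b c → 1 ≤ a + b → 1 ≤ b + c → 1 ≤ c + a → 2 ≤ a + (b + (c + 0))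
      at-least-two a b c ab bc ca = *-cancelˡ-< 2 1 _
          (≤-trans (+-mono-≤ ab (+-mono-≤ bc ca)) (≤-reflexive (double a b c)))
        where
        double : ∀ a b c → (a + b) + ((b + c) + (c + a)) ≡ 2 * (a + (b + (c + 0)))
        double = solve-∀
      at-most-two : ∀ a b c d e → a + b ≤ 1 → b + c ≤ 1 → c + d ≤ 1 → d + e ≤ 1 → e + a ≤ 1 →
          a + (b + (c + (d + (e + 0)))) ≤ 2
      at-most-two a b c d e ab bc cd de ea = ≤-pred
          (*-cancelˡ-< 2 _ 3 (s≤s (≤-trans (≤-reflexive (double a b c d e))
          (+-mono-≤ ab (+-mono-≤ bc (+-mono-≤ cd (+-mono-≤ de ea)))))))
        where
        double : ∀ a b c d e → 2 * (a + (b + (c + (d + (e + 0))))) ≡ (a + b) +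
            ((b + c) + ((c + d) + ((d + e) + (e + a))))
        double = solve-∀

  -- Condition (ii): triangles without short neighbours

  module AdjacencyFree (isolated : NoTriangleAdjacentTo3Or4Cycle G)
      (few-triangles : 5CyclesAdjacentToAtMostThreeTriangles G) where

    lone-triangle : ∀ {d} → In d → Closes 3 d → ¬ Across d
    lone-triangle {d} q own c = proj₁ (isolated (triangle q own)) (triangle-across q c)
      (different-from-own q own c , _ , _ , (0F , inj₁ (refl , refl)) , across-edge q c)

    no-4-cycle : ∀ {d} → In d → Closes 3 d → ¬ Closes 4 (α d)
    no-4-cycle {d} q own c = proj₂ (isolated (triangle q own)) (4-cycle (In-α q) c)
      (adjacent-longer {c = triangle q own} {d = 4-cycle (In-α q) c} ≤-refl (0F , inj₁ (refl , refl))
          (0F , inj₂ (p₀α d , p₁α d)))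

    receives : ∀ {d} → In d → Closes 3 d → 1 ≤ gift (α d)
    receives q own = gives-across (across-α own) (lone-triangle q own) (no-4-cycle q own)

    -- Gifts from four consecutive darts would yield four triangles adjacent to the pentagon,
    -- pairwise different because any two of the darts are at most two steps apart around it.
    -- Averaging over the five rotations then bounds all five gifts by 3.
    not-four : ∀ {d} → In d → Closes 5 d → gifts 4 d ≤ 3
    not-four {d} q c₅ = ≤-pred (count-< (λ i → gives? (iter face (toℕ i) d)) λ gives →
      differ (λ i → proj₁ (gives i)) (few-triangles (5-cycle q c₅) (across (λ i → proj₁ (gives i)))
          (adjacent (λ i → proj₁ (gives i)))))
      where
      AllAcross : Set
      AllAcross = ∀ (i : Fin 4) → Across (iter face (toℕ i) d)
      across : AllAcross → Fin 4 → Triangle G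
      across c i = triangle-across (In-iter (toℕ i) q) (c i)
      adjacent : ∀ c i → Adjacent (5-cycle q c₅) (across c i)
      adjacent c i = adjacent-shorter {c = across c i} {d = 5-cycle q c₅} (s≤s (s≤s (s≤s (s≤s z≤n))))
        (across-edge (In-iter (toℕ i) q) (c i)) (side i)
        where
        side : ∀ i → Cycle.HasEdge (5-cycle q c₅) (p (toℕ i) d) (p (suc (toℕ i)) d)
        side 0F = 0F , inj₁ (refl , refl)
        side 1F = 1F , inj₁ (refl , refl)
        side 2F = 2F , inj₁ (refl , refl)
        side 3F = 3F , inj₁ (refl , refl)
      -- Around the pentagon the fourth dart comes two steps before the first, so its triangle
      -- avoids the vertex where the first dart starts.
      first-last : ∀ c → ¬ across c 3F ≈ across c 0F
      first-last c e = turns-away (In-iter 3 q) (c 3F) (≈-hasVertex {across c 0F} {across c 3F}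
        (≈-sym {c = across c 3F} {d = across c 0F} e)
            (subst (Cycle.HasVertex (across c 0F)) (cong src (sym c₅)) (has-p₀ q (c 0F))))
      flip≈ : ∀ c i j → across c i ≈ across c j → across c j ≈ across c i
      flip≈ c i j = ≈-sym {c = across c i} {d = across c j}
      differ : ∀ c → ¬ ∃₂ λ i j → i ≢ j × across c i ≈ across c j
      differ c (0F , 0F , ≢ , e) = ≢ refl
      differ c (0F , 1F , _ , e) = different-from-next q (c 0F) (c 1F) e
      differ c (0F , 2F , _ , e) = different-from-second q (c 0F) (c 2F) e
      differ c (0F , 3F , _ , e) = first-last c (flip≈ c 0F 3F e)
      differ c (1F , 0F , _ , e) = different-from-next q (c 0F) (c 1F) (flip≈ c 1F 0F e)
      differ c (1F , 1F , ≢ , e) = ≢ refl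
      differ c (1F , 2F , _ , e) = different-from-next (In-iter 1 q) (c 1F) (c 2F) e
      differ c (1F , 3F , _ , e) = different-from-second (In-iter 1 q) (c 1F) (c 3F) e
      differ c (2F , 0F , _ , e) = different-from-second q (c 0F) (c 2F) (flip≈ c 2F 0F e)
      differ c (2F , 1F , _ , e) = different-from-next (In-iter 1 q) (c 1F) (c 2F) (flip≈ c 2F 1F e)
      differ c (2F , 2F , ≢ , e) = ≢ refl
      differ c (2F , 3F , _ , e) = different-from-next (In-iter 2 q) (c 2F) (c 3F) e
      differ c (3F , 0F , _ , e) = first-last c e
      differ c (3F , 1F , _ , e) = different-from-second (In-iter 1 q) (c 1F) (c 3F) (flip≈ c 3F 1F e)
      differ c (3F , 2F , _ , e) = different-from-next (In-iter 2 q) (c 2F) (c 3F) (flip≈ c 3F 2F e)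
      differ c (3F , 3F , ≢ , e) = ≢ refl

    sparse : darts ≤ 4 * order
    sparse = discharge-short-faces 3 (s≤s z≤n)
      (λ {d} q own → +-mono-≤ (receives q own)
          (+-mono-≤ (receives (In-iter 1 q) (closes-iter 1 3 own))
          (+-mono-≤ (receives (In-iter 2 q) (closes-iter 2 3 own)) z≤n)))
      (λ {d} q c₅ → at-most-three (gift (iter face 0 d)) (gift (iter face 1 d)) (gift (iter face 2 d))
          (gift (iter face 3 d)) (gift (iter face 4 d))
        (not-four q c₅)
        (not-four (In-iter 1 q) (closes-iter 1 5 c₅))
        (subst (λ e → gift (iter face 2 d) + (gift
            (iter face 3 d) + (gift (iter face 4 d) + (gift e + 0))) ≤ 3) c₅
            (not-four (In-iter 2 q) (closes-iter 2 5 c₅)))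
        (subst (λ e → gift (iter face 3 d) + (gift (iter face 4 d) + (gift e + (gift (face e) + 0))) ≤ 3) c₅
            (not-four (In-iter 3 q) (closes-iter 3 5 c₅)))
        (subst (λ e → gift (iter face 4 d) + (gift e + (gift (face e) + (gift (face (face e)) + 0))) ≤ 3) c₅
            (not-four (In-iter 4 q) (closes-iter 4 5 c₅))))
      (λ {d} q → ≤-trans (sum-mono-≤ {6} λ i →
          ⟦⟧≤1 (gives? (iter face (toℕ i) d))) (≤-reflexive (sum-const 6 1)))
      where
      at-most-three : ∀ a b c d e →
        a + (b + (c + (d + 0))) ≤ 3 → b + (c + (d + (e + 0))) ≤ 3 → c + (d + (e + (a + 0))) ≤ 3 →
        d + (e + (a + (b + 0))) ≤ 3 → e + (a + (b + (c + 0))) ≤ 3 → a + (b + (c + (d + (e + 0)))) ≤ 3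
      at-most-three a b c d e h₁ h₂ h₃ h₄ h₅ = ≤-pred
          (*-cancelˡ-< 4 _ 4 (s≤s (≤-trans (≤-reflexive (quadruple a b c d e))
        (+-mono-≤ h₁ (+-mono-≤ h₂ (+-mono-≤ h₃ (+-mono-≤ h₄ h₅)))))))
        where
        quadruple : ∀ a b c d e → 4 * (a + (b + (c + (d + (e + 0))))) ≡
          (a + (b + (c + (d + 0)))) + ((b + (c + (d + (e + 0)))) +
              ((c + (d + (e + (a + 0)))) + ((d + (e + (a + (b + 0)))) + (e + (a + (b + (c + 0)))))))
        quadruple = solve-∀

corollary4p2 : ∀ (n : ℕ) (G : Graph n) → Planar G →
    (NoIntersectingTriangles G × TrianglesAdjacentToAtMostOne4Cycle G)
    ⊎ (NoTriangleAdjacentTo3Or4Cycle G × 5CyclesAdjacentToAtMostThreeTriangles G) →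
    SingleConflictColorable G 3
corollary4p2 n G planar conditions with planar-dart-system G planar
... | Δ , M = Colouring.sparse⇒colorable Δ (min-degree-3-suffices Δ dense)
  where
  open DartSystem Δ
  open Induced Δ
  sparse : ∀ S → (∀ v → T (S v) → 3 ≤ degree S v) → DetachedMap (outside S) → darts S ≤ 4 * order S
  sparse S deg≥3 M′ =
    [ (λ (isolated , one-4-cycle) → Discharging.IntersectionFree.sparse Δ S deg≥3 M′ isolated one-4-cycle)
    , (λ (isolated , few-triangles) → Discharging.AdjacencyFree.sparse Δ S deg≥3 M′ isolated few-triangles)
    ]′ conditions
  dense : ∀ S → (∀ v → T (S v) → 3 ≤ degree S v) → darts S ≤ 4 * order S
  dense S deg≥3 = decidable-stable (_ ℕ.≤? _) (¬¬-map (sparse S deg≥3) (detach-all M (outside S)))
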